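{- For every integer $n\geqslant 0$, $$ \sum_{k=-\infty}^{\infty} (-1)^k\, b\big(n-k(3k-1)/2\big) = \begin{cases} s(n/2), & \text{for $n$ even,}\\ 0, & \text{for $n$ odd.} \end{cases} $$
   Context: For a nonnegative integer $n$: - $b(n)$ is the total number of parts in all the partitions of $n$ into odd parts minus the total number of parts in all the partitions of $n$ into distinct parts (parts counted with multiplicity). Thus $b(0)=0$, and by convention $b(m)=0$ for $m<0$. - $s(n)$ is the total number of parts in all the partitions of $n$ into an odd number of distinct parts minus the total number of parts in all the partitions of $n$ into an even number of distinct parts. For example $s(5)=1-2-2=-3$, and $s(0)=0$. The sum over $k$ runs over all integers and has only finitely many nonzero terms. -}

module Defs where

open import Data.Empty using (⊥-elim)
open import Data.Integer.Base as ℤ using (ℤ; +_; -[1+_]; 0ℤ; -1ℤ; ∣_∣; _/ℕ_)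
import Data.Integer.Properties as ℤₚ
open import Data.List.Base using (List; []; _∷_; _++_; map; filter; concatMap; replicate; upTo; length; foldr)
open import Data.List.Membership.Propositional using (_∈_; _∉_; lose; find)
open import Data.List.Membership.Propositional.Properties using (∈-map⁺; ∈-map⁻; ∈-concatMap⁺; ∈-concatMap⁻; ∈-upTo⁺; ∈-upTo⁻; ∈-filter⁺; ∈-filter⁻)
open import Data.List.Membership.Propositional.Properties.WithK using (unique∧set⇒bag)
open import Data.List.Membership.DecPropositional ℤₚ._≟_ using (_∈?_)
open import Data.List.Properties using (++-cancelˡ; ∷-injectiveʳ)
open import Data.List.Relation.Binary.BagAndSetEquality using (∼bag⇒↭)
open import Data.List.Relation.Binary.Disjoint.Propositional using (Disjoint)
open import Data.List.Relation.Binary.Permutation.Propositional using (_↭_; refl; prep; swap; trans)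
open import Data.List.Relation.Unary.All as All using (All; []; _∷_)
import Data.List.Relation.Unary.All.Properties as All
open import Data.List.Relation.Unary.AllPairs as AllPairs using (AllPairs; []; _∷_)
import Data.List.Relation.Unary.AllPairs.Properties as AllPairs
open import Data.List.Relation.Unary.Any using (here)
open import Data.List.Relation.Unary.Unique.Propositional using (Unique)
import Data.List.Relation.Unary.Unique.Propositional.Properties as Unique
open import Data.List.Relation.Unary.Unique.DecPropositional using (unique?)
open import Data.Nat.Base using (ℕ; zero; suc; _+_; _*_; _∸_; _/_; _≤_; _<_; _≥_; z≤n; s≤s)
open import Data.Nat.Divisibility using (_∣_; _∤_; _∣?_)
open import Data.Nat.DivMod using (m/n*n≤m; m*n/n≡m; /-monoˡ-≤)
open import Data.Nat.ListAction using (sum)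
import Data.Nat.Properties as ℕ
open import Data.Product.Base using (∃; _×_; _,_; proj₁; proj₂)
open import Data.Sum.Base using (inj₁; inj₂)
open import Function.Bundles using (_⇔_; mk⇔)
open import Relation.Binary.PropositionalEquality using (_≡_; _≢_; refl; sym; cong; cong₂; subst; module ≡-Reasoning) renaming (trans to ≡-trans)
open import Relation.Nullary.Decidable using (yes; no; ¬?; _×-dec_)
open import Relation.Nullary.Negation using (contradiction)
open import Relation.Unary using (Pred; Decidable)
open import Level using (0ℓ)

-- A partition is the list of its parts in weakly decreasing order.
record IsPartition (n : ℕ) (p : List ℕ) : Set where
  constructor mkIsPartition
  field
    positive   : All (0 <_) p
    decreasing : AllPairs _≥_ p
    total      : sum p ≡ n

-- boundedPartitions m n lists the partitions of n with all parts ≤ m; in the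
-- last clause, j is the multiplicity of the part suc m.
boundedPartitions : ℕ → ℕ → List (List ℕ)
boundedPartitions zero    zero    = [] ∷ []
boundedPartitions zero    (suc n) = []
boundedPartitions (suc m) n       =
  concatMap (λ j → map (replicate j (suc m) ++_) (boundedPartitions m (n ∸ j * suc m)))
            (upTo (suc (n / suc m)))

-- ∈-partitions and partitions-unique below show that every partition of n
-- occurs in this list exactly once.
partitions : ℕ → List (List ℕ)
partitions n = boundedPartitions n n

totalParts : {P : Pred (List ℕ) 0ℓ} → Decidable P → ℕ → ℕ
totalParts P? n = sum (map length (filter P? (partitions n)))

OddParts : Pred (List ℕ) 0ℓ
OddParts = All (2 ∤_)

DistinctParts : Pred (List ℕ) 0ℓ
DistinctParts = Unique

oddParts? : Decidable OddParts
oddParts? = All.all? (λ i → ¬? (2 ∣? i))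

distinctParts? : Decidable DistinctParts
distinctParts? = unique? ℕ._≟_

evenlyManyDistinctParts? : Decidable (λ p → DistinctParts p × 2 ∣ length p)
evenlyManyDistinctParts? p = distinctParts? p ×-dec (2 ∣? length p)

oddlyManyDistinctParts? : Decidable (λ p → DistinctParts p × 2 ∤ length p)
oddlyManyDistinctParts? p = distinctParts? p ×-dec ¬? (2 ∣? length p)

b : ℤ → ℤ
b (+ n)    = + totalParts oddParts? n ℤ.- + totalParts distinctParts? n
b -[1+ _ ] = 0ℤ

s : ℕ → ℤ
s n = + totalParts oddlyManyDistinctParts? n ℤ.- + totalParts evenlyManyDistinctParts? n

-- k(3k - 1) is even, so the division is exact.
pentagonal : ℤ → ℤ
pentagonal k = (k ℤ.* (+ 3 ℤ.* k ℤ.- + 1)) /ℕ 2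

-- (-1)ᵏ = (-1)^∣k∣ also for negative k.
sign : ℤ → ℤ
sign k = -1ℤ ℤ.^ ∣ k ∣

sumOver : (ℤ → ℤ) → List ℤ → ℤ
sumOver f = foldr (λ k acc → f k ℤ.+ acc) 0ℤ

-- The family f has only finitely many nonzero terms, and they add up to v.
-- HasSum-unique below shows that v does not depend on the list chosen.
record HasSum (f : ℤ → ℤ) (v : ℤ) : Set where
  field
    indices  : List ℤ
    distinct : Unique indices
    vanishes : ∀ k → k ∉ indices → f k ≡ 0ℤ
    value    : sumOver f indices ≡ v

private
  sumOver-↭ : ∀ f {ks ls} → ks ↭ ls → sumOver f ks ≡ sumOver f ls
  sumOver-↭ f refl        = refl
  sumOver-↭ f (prep x p)  = cong (λ z → f x ℤ.+ z) (sumOver-↭ f p)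
  sumOver-↭ f (swap {ks} {ls} x y p) = begin
    f x ℤ.+ (f y ℤ.+ sumOver f ks) ≡⟨ ℤₚ.+-assoc (f x) (f y) _ ⟨
    (f x ℤ.+ f y) ℤ.+ sumOver f ks ≡⟨ cong₂ ℤ._+_ (ℤₚ.+-comm (f x) (f y)) (sumOver-↭ f p) ⟩
    (f y ℤ.+ f x) ℤ.+ sumOver f ls ≡⟨ ℤₚ.+-assoc (f y) (f x) _ ⟩
    f y ℤ.+ (f x ℤ.+ sumOver f ls) ∎
    where open ≡-Reasoning
  sumOver-↭ f (trans p q) = ≡-trans (sumOver-↭ f p) (sumOver-↭ f q)

  module _ (f : ℤ → ℤ) where
    nonzero? : Decidable (λ k → f k ≢ 0ℤ)
    nonzero? k = ¬? (f k ℤₚ.≟ 0ℤ)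

    sumOver-nonzero : ∀ ks → sumOver f (filter nonzero? ks) ≡ sumOver f ks
    sumOver-nonzero []       = refl
    sumOver-nonzero (k ∷ ks) with f k ℤₚ.≟ 0ℤ
    ... | no  _    = cong (λ z → f k ℤ.+ z) (sumOver-nonzero ks)
    ... | yes fk≡0 rewrite fk≡0 | ℤₚ.+-identityˡ (sumOver f ks) = sumOver-nonzero ks

    nonzero-⊆ : ∀ {ks ls} → (∀ k → k ∉ ls → f k ≡ 0ℤ) →
                ∀ {k} → k ∈ filter nonzero? ks → k ∈ filter nonzero? ls
    nonzero-⊆ {ks} {ls} van {k} k∈ with ∈-filter⁻ nonzero? {xs = ks} k∈ | k ∈? ls
    ... | _ , fk≢0 | yes k∈ls = ∈-filter⁺ nonzero? k∈ls fk≢0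
    ... | _ , fk≢0 | no  k∉ls = contradiction (van k k∉ls) fk≢0

HasSum-unique : ∀ {f v w} → HasSum f v → HasSum f w → v ≡ w
HasSum-unique {f} {v} {w} S T = begin
  v                                         ≡⟨ S.value ⟨
  sumOver f S.indices                       ≡⟨ sumOver-nonzero f S.indices ⟨
  sumOver f (filter (nonzero? f) S.indices) ≡⟨ sumOver-↭ f (∼bag⇒↭ (unique∧set⇒bag
                                                 (Unique.filter⁺ (nonzero? f) S.distinct)
                                                 (Unique.filter⁺ (nonzero? f) T.distinct)
                                                 (mk⇔ (nonzero-⊆ f {ks = S.indices} T.vanishes)
                                                      (nonzero-⊆ f {ks = T.indices} S.vanishes)))) ⟩
  sumOver f (filter (nonzero? f) T.indices) ≡⟨ sumOver-nonzero f T.indices ⟩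
  sumOver f T.indices                       ≡⟨ T.value ⟩
  w                                         ∎
  where
  open ≡-Reasoning
  module S = HasSum S
  module T = HasSum T

private
  IsBounded : ℕ → ℕ → Pred (List ℕ) 0ℓ
  IsBounded m n p = IsPartition n p × All (_≤ m) p

  replicate-bounded : ∀ m j {n q} → IsBounded m n q →
                      IsBounded (suc m) (j * suc m + n) (replicate j (suc m) ++ q)
  replicate-bounded m zero (qp , q≤m) = qp , All.map ℕ.m≤n⇒m≤1+n q≤m
  replicate-bounded m (suc j) {n} {q} qb with replicate-bounded m j qb
  ... | mkIsPartition pos dec tot , p≤ =
    mkIsPartition (s≤s z≤n ∷ pos) (p≤ ∷ dec)
      (≡-trans (cong (λ z → suc m + z) tot) (sym (ℕ.+-assoc (suc m) (j * suc m) n)))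
    , ℕ.≤-refl ∷ p≤

  ∈⇒bounded : ∀ m n {p} → p ∈ boundedPartitions m n → IsBounded m n p
  ∈⇒bounded zero    zero    (here refl) = mkIsPartition [] [] refl , []
  ∈⇒bounded (suc m) n       p∈
    with find (∈-concatMap⁻ (λ j → map (replicate j (suc m) ++_) (boundedPartitions m (n ∸ j * suc m))) {xs = upTo (suc (n / suc m))} p∈)
  ... | j , j∈ , p∈ⱼ with ∈-map⁻ (replicate j (suc m) ++_) p∈ⱼ
  ... | q , q∈ , refl =
    subst (λ k → IsBounded (suc m) k (replicate j (suc m) ++ q)) (ℕ.m+[n∸m]≡n j*≤n)
      (replicate-bounded m j (∈⇒bounded m (n ∸ j * suc m) q∈))
    where
    j≤ : j ≤ n / suc m
    j≤ = ℕ.≤-pred (∈-upTo⁻ j∈)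
    j*≤n : j * suc m ≤ n
    j*≤n = ℕ.≤-trans (ℕ.*-monoˡ-≤ (suc m) j≤) (m/n*n≤m n (suc m))

  split : ∀ m p → All (0 <_) p → AllPairs _≥_ p → All (_≤ suc m) p →
          ∃ λ j → ∃ λ q → p ≡ replicate j (suc m) ++ q × sum p ≡ j * suc m + sum q × IsBounded m (sum q) q
  split m []      _   _   _  = 0 , [] , refl , refl , mkIsPartition [] [] refl , []
  split m (x ∷ p) (x>0 ∷ pos) (x≥ ∷ dec) (x≤ ∷ p≤) with ℕ.m≤n⇒m<n∨m≡n x≤
  ... | inj₁ x<m  = 0 , x ∷ p , refl , refl , mkIsPartition (x>0 ∷ pos) (x≥ ∷ dec) refl ,
                    ℕ.≤-pred x<m ∷ All.map (λ y≤x → ℕ.≤-trans y≤x (ℕ.≤-pred x<m)) x≥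
  ... | inj₂ refl with split m p pos dec p≤
  ... | j , q , refl , eq , qb = suc j , q , refl ,
      ≡-trans (cong (λ z → suc m + z) eq) (sym (ℕ.+-assoc (suc m) (j * suc m) (sum q))) , qb

  bounded⇒∈ : ∀ m n {p} → IsBounded m n p → p ∈ boundedPartitions m n
  bounded⇒∈ zero _ {[]}    (mkIsPartition _ _ refl , _) = here refl
  bounded⇒∈ zero _ {_ ∷ _} (mkIsPartition (x>0 ∷ _) _ _ , (x≤0 ∷ _)) = contradiction x≤0 (ℕ.<⇒≱ x>0)
  bounded⇒∈ (suc m) _ {p} (mkIsPartition pos dec refl , p≤) with split m p pos dec p≤
  ... | j , q , refl , eq , qb =
    ∈-concatMap⁺ (λ i → map (replicate i (suc m) ++_) (boundedPartitions m (sum (replicate j (suc m) ++ q) ∸ i * suc m)))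
      (lose (∈-upTo⁺ (s≤s j≤))
            (∈-map⁺ (replicate j (suc m) ++_) (bounded⇒∈ m _ (subst (λ k → IsBounded m k q) rest qb))))
    where
    rest : sum q ≡ sum (replicate j (suc m) ++ q) ∸ j * suc m
    rest = sym (≡-trans (cong (_∸ j * suc m) eq) (ℕ.m+n∸m≡n (j * suc m) (sum q)))
    j≤ : j ≤ sum (replicate j (suc m) ++ q) / suc m
    j≤ = subst (_≤ sum (replicate j (suc m) ++ q) / suc m) (m*n/n≡m j (suc m))
           (/-monoˡ-≤ (suc m) (subst (j * suc m ≤_) (sym eq) (ℕ.m≤m+n (j * suc m) (sum q))))

  multiplicity-unique : ∀ m i j {p q} → All (_≤ m) p → All (_≤ m) q →
                        replicate i (suc m) ++ p ≡ replicate j (suc m) ++ q → i ≡ j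
  multiplicity-unique m zero    zero    _          _          _    = refl
  multiplicity-unique m zero    (suc j) (x≤m ∷ _) _          refl = ⊥-elim (ℕ.1+n≰n x≤m)
  multiplicity-unique m (suc i) zero    _          (x≤m ∷ _) refl = ⊥-elim (ℕ.1+n≰n x≤m)
  multiplicity-unique m (suc i) (suc j) p≤         q≤         eq   =
    cong suc (multiplicity-unique m i j p≤ q≤ (∷-injectiveʳ eq))

  bounded-unique : ∀ m n → Unique (boundedPartitions m n)
  bounded-unique zero    zero    = [] ∷ []
  bounded-unique zero    (suc n) = []
  bounded-unique (suc m) n       = Unique.concat⁺
    (All.map⁺ (All.universal (λ j → Unique.map⁺ (++-cancelˡ (replicate j (suc m)) _ _) (bounded-unique m _)) _))
    (AllPairs.map⁺ {f = block} (AllPairs.map disjoint (Unique.upTo⁺ (suc (n / suc m)))))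
    where
    block : ℕ → List (List ℕ)
    block j = map (replicate j (suc m) ++_) (boundedPartitions m (n ∸ j * suc m))
    disjoint : ∀ {i j} → i ≢ j → Disjoint (block i) (block j)
    disjoint {i} {j} i≢j (p∈ᵢ , p∈ⱼ)
      with ∈-map⁻ (replicate i (suc m) ++_) p∈ᵢ | ∈-map⁻ (replicate j (suc m) ++_) p∈ⱼ
    ... | q , q∈ , eq | r , r∈ , eq′ = i≢j (multiplicity-unique m i j
      (proj₂ (∈⇒bounded m _ q∈)) (proj₂ (∈⇒bounded m _ r∈)) (≡-trans (sym eq) eq′))

  parts≤sum : ∀ p → All (_≤ sum p) p
  parts≤sum []      = []
  parts≤sum (x ∷ p) = ℕ.m≤m+n x (sum p) ∷ All.map (λ y≤ → ℕ.≤-trans y≤ (ℕ.m≤n+m (sum p) x)) (parts≤sum p)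

∈-partitions : ∀ {n p} → p ∈ partitions n ⇔ IsPartition n p
∈-partitions {n} {p} = mk⇔ (λ p∈ → proj₁ (∈⇒bounded n n p∈)) from
  where
  from : IsPartition n p → p ∈ partitions n
  from pp@(mkIsPartition _ _ refl) = bounded⇒∈ n n (pp , parts≤sum p)

partitions-unique : ∀ n → Unique (partitions n)
partitions-unique n = bounded-unique n n

{-# OPTIONS --safe #-}

-- Write P = ∏ (1 - qⁱ) and Λ = ∑ qⁱ/(1 - qⁱ).  Logarithmic differentiation in a
-- variable marking the parts shows that the numbers of parts of the partitions
-- into odd and into distinct parts have generating functions
--   ∏ 1/(1 - q²ⁱ⁻¹) · ∑ q²ⁱ⁻¹/(1 - q²ⁱ⁻¹)  and  ∏ (1 + qⁱ) · ∑ qⁱ/(1 + qⁱ),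
-- and that s has generating function P Λ.  By Euler the two products are equal,
-- and the two sums are Λ - Λ(q²) and Λ - 2Λ(q²), so b has generating function
-- P(q²)/P · Λ(q²).  Multiplying by P, which is ∑ (-1)ᵏ q^(k(3k-1)/2), gives
-- (P Λ)(q²).  The infinite products and sums are replaced by finite ones which
-- agree with them up to the coefficient in question.

module Submission where

open import Defs
open import Algebra.Bundles using (CommutativeRing)
import Algebra.Solver.Ring
open import Algebra.Solver.Ring.AlmostCommutativeRing using (fromCommutativeRing; _-Raw-AlmostCommutative⟶_)
open import Data.Bool.Base using (if_then_else_; true; false; not; _∧_)
open import Data.Integer.Base as ℤ using (ℤ; +_; -[1+_]; 0ℤ; 1ℤ; -1ℤ; _/ℕ_)
import Data.Integer.Properties as ℤ
open import Data.Integer.Tactic.RingSolver using (solve-∀)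
open import Data.List.Base using (List; []; _∷_; _++_; map; concatMap; filter; length; replicate; upTo; applyUpTo; foldr)
open import Data.List.Membership.Propositional using (_∈_; _∉_)
open import Data.List.Properties using (map-id; ++-identityʳ)
open import Data.List.Relation.Unary.All as All using (All; []; _∷_)
import Data.List.Relation.Unary.All.Properties as All
open import Data.List.Relation.Unary.AllPairs using ([]; _∷_)
open import Data.List.Relation.Unary.Any using (here; there)
open import Data.List.Relation.Unary.Unique.Propositional using (Unique)
import Data.Maybe.Base as Maybe
open import Data.Nat.Base using (ℕ; zero; suc; _+_; _*_; _∸_; _/_; _≤_; _<_; z≤n; s≤s; NonZero)
open import Data.Nat.Divisibility using (_∣_; _∤_; _∣?_; divides)
import Data.Nat.Divisibility as ℕ
open import Data.Nat.DivMod using (m<n⇒m/n≡0; m/n≡1+[m∸n]/n; m*n/n≡m; m/n≤m)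
open import Data.Nat.ListAction using (sum)
import Data.Nat.Properties as ℕ
open import Data.Nat.Tactic.RingSolver using () renaming (solve-∀ to ℕ-solve-∀)
open import Data.Product.Base using (_,_)
open import Data.Sum.Base using (inj₁; inj₂)
open import Function.Base using (_∘_)
open import Function.Bundles using (mk⇔)
open import Level using (0ℓ)
open import Relation.Binary.PropositionalEquality using (_≡_; refl; sym; trans; cong; cong₂; subst)
import Relation.Binary.Reasoning.Setoid
open import Relation.Binary.Structures using (IsEquivalence)
open import Relation.Nullary.Decidable using (yes; no; does; does-⇔; dec⇒maybe; dec-true; dec-false)
open import Relation.Unary using (Pred; Decidable)

-- Formal power series over ℤ

-- No quotient is ever formed. Euler's identity is used as the two product formulas P ∏ (1 + qⁱ) =
-- P(q²) and P ∏ 1/(1 - q²ⁱ⁻¹) = P(q²), and the series of b is multiplied by P from the outset. Both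
-- formulas have exact finite forms, but of different shape: for distinct parts m factors on the
-- left match m on the right, for odd parts 2m factors match m. The Lambert sums behave in the same
-- way. Subtracting the distinct count from the odd count therefore brings in two cut-offs, N and
-- 2N, and the coefficient N is all that survives the passage between them. Identities about f(qᵏ)
-- are reduced to uniqueness: writing f = f(0) + q t, both sides, as functions of f, solve the same
-- equation Φ(f) = h(f) + qᵏ Φ(t). The same principle links products with f(qᵏ) to the enumeration
-- of partitions by the multiplicity of the largest admissible part.

Series : Set
Series = ℕ → ℤ

infix 4 _≈_

record _≈_ (f g : Series) : Set where
  constructor coefficientwise
  field
    at : ∀ n → f n ≡ g n

open _≈_

infixl 6 _⊕_
infixl 7 _⊛_ _∙_
infix  8 ⊝_

C : ℤ → Series
C a zero    = a
C a (suc n) = 0ℤ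

-- The Cauchy product is read off from f = f(0) + q t, where t is `f ∘ suc`. Only the left factor is
-- peeled, so inductions on the coefficient must leave `f` general.
_⊕_ _⊛_ : Series → Series → Series
(f ⊕ g) n = f n ℤ.+ g n
(f ⊛ g) zero    = f 0 ℤ.* g 0
(f ⊛ g) (suc n) = f 0 ℤ.* g (suc n) ℤ.+ ((f ∘ suc) ⊛ g) n

⊝_ : Series → Series
(⊝ f) n = ℤ.- f n

_∙_ : ℤ → Series → Series
(a ∙ f) n = a ℤ.* f n

-- The truncation principle: coefficient `n` of a product sees no coefficient beyond `n` of either
-- factor. Later this exchanges finite products and sums with different cut-offs.
⊛-cong-≤ : ∀ n {f f′ g g′ : Series} → (∀ {i} → i ≤ n → f i ≡ f′ i) → (∀ {i} → i ≤ n → g i ≡ g′ i) →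
           (f ⊛ g) n ≡ (f′ ⊛ g′) n
⊛-cong-≤ zero    p q = cong₂ ℤ._*_ (p z≤n) (q z≤n)
⊛-cong-≤ (suc n) p q = cong₂ ℤ._+_ (cong₂ ℤ._*_ (p z≤n) (q ℕ.≤-refl))
  (⊛-cong-≤ n (λ i≤n → p (s≤s i≤n)) (λ i≤n → q (ℕ.m≤n⇒m≤1+n i≤n)))

C0 : ∀ n → C 0ℤ n ≡ 0ℤ
C0 zero    = refl
C0 (suc n) = refl

zero-⊛ : ∀ {f} → (∀ n → f n ≡ 0ℤ) → ∀ g n → (f ⊛ g) n ≡ 0ℤ
zero-⊛ f≡0 g zero    = cong (ℤ._* g 0) (f≡0 0)
zero-⊛ f≡0 g (suc n) = cong₂ ℤ._+_ (cong (ℤ._* g (suc n)) (f≡0 0)) (zero-⊛ (f≡0 ∘ suc) g n)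

C-⊛ : ∀ a g n → (C a ⊛ g) n ≡ a ℤ.* g n
C-⊛ a g zero    = refl
C-⊛ a g (suc n) = trans (cong (λ z → a ℤ.* g (suc n) ℤ.+ z) (zero-⊛ (λ _ → refl) g n)) (ℤ.+-identityʳ _)

⊛-distribʳ : ∀ f g h n → ((f ⊕ g) ⊛ h) n ≡ (f ⊛ h) n ℤ.+ (g ⊛ h) n
⊛-distribʳ f g h zero    = ℤ.*-distribʳ-+ (h 0) (f 0) (g 0)
⊛-distribʳ f g h (suc n) rewrite ⊛-distribʳ (f ∘ suc) (g ∘ suc) h n =
  rearrange (f 0) (g 0) (h (suc n)) (((f ∘ suc) ⊛ h) n) (((g ∘ suc) ⊛ h) n)
  where
  rearrange : ∀ a b c x y → (a ℤ.+ b) ℤ.* c ℤ.+ (x ℤ.+ y) ≡ (a ℤ.* c ℤ.+ x) ℤ.+ (b ℤ.* c ℤ.+ y)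
  rearrange = solve-∀

∙-⊛ : ∀ a f g n → ((a ∙ f) ⊛ g) n ≡ a ℤ.* (f ⊛ g) n
∙-⊛ a f g zero    = ℤ.*-assoc a (f 0) (g 0)
∙-⊛ a f g (suc n) rewrite ∙-⊛ a (f ∘ suc) g n = rearrange a (f 0) (g (suc n)) (((f ∘ suc) ⊛ g) n)
  where
  rearrange : ∀ a b c x → a ℤ.* b ℤ.* c ℤ.+ a ℤ.* x ≡ a ℤ.* (b ℤ.* c ℤ.+ x)
  rearrange = solve-∀

⊛-assoc : ∀ f g h n → ((f ⊛ g) ⊛ h) n ≡ (f ⊛ (g ⊛ h)) n
⊛-assoc f g h zero    = ℤ.*-assoc (f 0) (g 0) (h 0)
⊛-assoc f g h (suc n)
  -- By definition `(f ⊛ g) ∘ suc` is `f 0 ∙ (g ∘ suc) ⊕ (f ∘ suc) ⊛ g`, which is why distributivity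
  -- and scaling come before associativity.
  rewrite ⊛-distribʳ (f 0 ∙ (g ∘ suc)) ((f ∘ suc) ⊛ g) h n
        | ∙-⊛ (f 0) (g ∘ suc) h n
        | ⊛-assoc (f ∘ suc) g h n = rearrange (f 0) (g 0) (h (suc n)) (((g ∘ suc) ⊛ h) n) (((f ∘ suc) ⊛ (g ⊛ h)) n)
  where
  rearrange : ∀ a b c x y → a ℤ.* b ℤ.* c ℤ.+ (a ℤ.* x ℤ.+ y) ≡ a ℤ.* (b ℤ.* c ℤ.+ x) ℤ.+ y
  rearrange = solve-∀

-- The mirror image of the defining equation, peeling the right factor; commutativity needs it
-- because the definition is lopsided.
⊛-sucʳ : ∀ f g n → (f ⊛ g) (suc n) ≡ (f ⊛ (g ∘ suc)) n ℤ.+ f (suc n) ℤ.* g 0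
⊛-sucʳ f g zero    = refl
⊛-sucʳ f g (suc n) rewrite ⊛-sucʳ (f ∘ suc) g n = sym (ℤ.+-assoc (f 0 ℤ.* g (2 + n)) _ _)

⊛-comm : ∀ f g n → (f ⊛ g) n ≡ (g ⊛ f) n
⊛-comm f g zero    = ℤ.*-comm (f 0) (g 0)
⊛-comm f g (suc n) rewrite ⊛-sucʳ g f n | ⊛-comm (f ∘ suc) g n | ℤ.*-comm (f 0) (g (suc n)) =
  ℤ.+-comm (g (suc n) ℤ.* f 0) _

C-⊕ : ∀ a b n → C (a ℤ.+ b) n ≡ (C a ⊕ C b) n
C-⊕ a b zero    = refl
C-⊕ a b (suc n) = refl

≈-isEquivalence : IsEquivalence _≈_
≈-isEquivalence = record
  { refl  = coefficientwise λ _ → refl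
  ; sym   = λ p → coefficientwise λ n → sym (at p n)
  ; trans = λ p q → coefficientwise λ n → trans (at p n) (at q n)
  }

seriesRing : CommutativeRing 0ℓ 0ℓ
seriesRing = record
  { Carrier = Series ; _≈_ = _≈_ ; _+_ = _⊕_ ; _*_ = _⊛_ ; -_ = ⊝_ ; 0# = C 0ℤ ; 1# = C 1ℤ
  ; isCommutativeRing = record
    { isRing = record
      { +-isAbelianGroup = record
        { isGroup = record
          { isMonoid = record
            { isSemigroup = record
              { isMagma = record
                { isEquivalence = ≈-isEquivalence
                ; ∙-cong = λ p q → coefficientwise λ n → cong₂ ℤ._+_ (at p n) (at q n)
                }
              ; assoc = λ f g h → coefficientwise λ n → ℤ.+-assoc (f n) (g n) (h n)
              }
            ; identity = (λ f → coefficientwise (identityˡ f)) ,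
                         (λ f → coefficientwise λ n → trans (ℤ.+-comm (f n) (C 0ℤ n)) (identityˡ f n))
            }
          ; inverse = (λ f → coefficientwise λ n → trans (ℤ.+-inverseˡ (f n)) (sym (C0 n))) ,
                      (λ f → coefficientwise λ n → trans (ℤ.+-inverseʳ (f n)) (sym (C0 n)))
          ; ⁻¹-cong = λ p → coefficientwise λ n → cong ℤ.-_ (at p n)
          }
        ; comm = λ f g → coefficientwise λ n → ℤ.+-comm (f n) (g n)
        }
      ; *-cong = λ p q → coefficientwise λ n → ⊛-cong-≤ n (λ {i} _ → at p i) (λ {i} _ → at q i)
      ; *-assoc = λ f g h → coefficientwise (⊛-assoc f g h)
      ; *-identity = (λ f → coefficientwise (one f)) ,
                     (λ f → coefficientwise λ n → trans (⊛-comm f (C 1ℤ) n) (one f n))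
      ; distrib = (λ f g h → coefficientwise λ n →
                    trans (⊛-comm f (g ⊕ h) n) (trans (⊛-distribʳ g h f n) (cong₂ ℤ._+_ (⊛-comm g f n) (⊛-comm h f n)))) ,
                  (λ f g h → coefficientwise (⊛-distribʳ g h f))
      }
    ; *-comm = λ f g → coefficientwise (⊛-comm f g)
    }
  }
  where
  identityˡ : ∀ f n → C 0ℤ n ℤ.+ f n ≡ f n
  identityˡ f n rewrite C0 n = ℤ.+-identityˡ (f n)
  one : ∀ f n → (C 1ℤ ⊛ f) n ≡ f n
  one f n = trans (C-⊛ 1ℤ f n) (ℤ.*-identityˡ (f n))

private module R = CommutativeRing seriesRing
open Relation.Binary.Reasoning.Setoid R.setoid

C-⊝ : ∀ a → C (ℤ.- a) ≈ ⊝ C a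
C-⊝ a = coefficientwise λ { zero → refl ; (suc n) → refl }

-- Lets the ring solver compute with integer coefficients, so that constants such as -1 and 2 cancel
-- inside series identities.
C-homomorphism : ℤ.+-*-rawRing -Raw-AlmostCommutative⟶ fromCommutativeRing seriesRing
C-homomorphism = record
  { ⟦_⟧    = C
  ; +-homo = λ a b → coefficientwise (C-⊕ a b)
  ; *-homo = λ a b → coefficientwise λ { zero → refl ; (suc n) → sym (trans (C-⊛ a (C b) (suc n)) (ℤ.*-zeroʳ a)) }
  ; -‿homo = C-⊝
  ; 0-homo = R.refl
  ; 1-homo = R.refl
  }

open Algebra.Solver.Ring ℤ.+-*-rawRing (fromCommutativeRing seriesRing) C-homomorphism
  (λ a b → Maybe.map (λ a≡b → R.reflexive (cong C a≡b)) (dec⇒maybe (a ℤ.≟ b)))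
  using (solve; _:=_; _:+_; _:*_; :-_; con)

-- Monomials and shifting of coefficients

mono : ℕ → Series
mono zero            = C 1ℤ
mono (suc k) zero    = 0ℤ
mono (suc k) (suc n) = mono k n

X : Series
X = mono 1

mono-suc-⊛ : ∀ k f n → (mono (suc k) ⊛ f) (suc n) ≡ (mono k ⊛ f) n
mono-suc-⊛ k f n = trans (cong (ℤ._+ (mono k ⊛ f) n) (ℤ.*-zeroˡ (f (suc n)))) (ℤ.+-identityˡ _)

mono-⊛-< : ∀ {k} f {n} → n < k → (mono k ⊛ f) n ≡ 0ℤ
mono-⊛-< {suc k} f {zero}  _         = ℤ.*-zeroˡ (f 0)
mono-⊛-< {suc k} f {suc n} (s≤s n<k) = trans (mono-suc-⊛ k f n) (mono-⊛-< f n<k)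

mono-⊛-+ : ∀ k f n → (mono k ⊛ f) (k + n) ≡ f n
mono-⊛-+ zero    f n = at (R.*-identityˡ f) n
mono-⊛-+ (suc k) f n = trans (mono-suc-⊛ k f (k + n)) (mono-⊛-+ k f n)

mono-⊛-≥ : ∀ {k} f {n} → k ≤ n → (mono k ⊛ f) n ≡ f (n ∸ k)
mono-⊛-≥ {k} f {n} k≤n = trans (cong (mono k ⊛ f) (sym (ℕ.m+[n∸m]≡n k≤n))) (mono-⊛-+ k f (n ∸ k))

mono-+ : ∀ k l → mono k ⊛ mono l ≈ mono (k + l)
mono-+ zero    l = R.*-identityˡ (mono l)
mono-+ (suc k) l = coefficientwise λ
  { zero    → ℤ.*-zeroˡ (mono l 0)
  ; (suc n) → trans (mono-suc-⊛ k (mono l) n) (at (mono-+ k l) n)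
  }

head-tail : ∀ f → f ≈ C (f 0) ⊕ X ⊛ (f ∘ suc)
head-tail f = coefficientwise λ
  { zero    → sym (trans (cong (λ z → f 0 ℤ.+ z) (ℤ.*-zeroˡ (f 1))) (ℤ.+-identityʳ (f 0)))
  ; (suc n) → sym (trans (ℤ.+-identityˡ _) (mono-⊛-+ 1 (f ∘ suc) n))
  }

-- Such an equation determines the series Φ a from its lower coefficients.
recursion-unique : ∀ {A : Set} k {Φ Ψ h : A → Series} (next : A → A) →
                   (∀ a → Φ a ≈ h a ⊕ mono (suc k) ⊛ Φ (next a)) →
                   (∀ a → Ψ a ≈ h a ⊕ mono (suc k) ⊛ Ψ (next a)) →
                   ∀ a → Φ a ≈ Ψ a
recursion-unique {A} k {Φ} {Ψ} {h} next Φ-rec Ψ-rec a = coefficientwise λ n → below (suc n) a ℕ.≤-refl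
  where
  below : ∀ N a {n} → n < N → Φ a n ≡ Ψ a n
  shifted : ∀ N a n → n < N → (mono (suc k) ⊛ Φ a) n ≡ (mono (suc k) ⊛ Ψ a) n
  below (suc N) a {n} n<N =
    trans (at (Φ-rec a) n) (trans (cong (λ z → h a n ℤ.+ z) (shifted (suc N) (next a) n n<N)) (sym (at (Ψ-rec a) n)))
  shifted (suc N) a zero    _         = trans (ℤ.*-zeroˡ (Φ a 0)) (sym (ℤ.*-zeroˡ (Ψ a 0)))
  shifted (suc N) a (suc n) (s≤s n<N) = trans (mono-suc-⊛ k (Φ a) n)
    (trans (⊛-cong-≤ n {mono k} (λ _ → refl) (λ i≤n → below N a (ℕ.≤-<-trans i≤n n<N)))
           (sym (mono-suc-⊛ k (Ψ a) n)))

-- Substitution of qᵏ for q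

dilate : ∀ k .⦃ _ : NonZero k ⦄ → Series → Series
dilate k f n = if does (k ∣? n) then f (n / k) else 0ℤ

module _ (k : ℕ) .⦃ _ : NonZero k ⦄ where

  dilate-cong : ∀ {f g} → f ≈ g → dilate k f ≈ dilate k g
  dilate-cong p = coefficientwise λ n → cong (if does (k ∣? n) then_else 0ℤ) (at p (n / k))

  dilate-⊕ : ∀ f g → dilate k (f ⊕ g) ≈ dilate k f ⊕ dilate k g
  dilate-⊕ f g = coefficientwise λ n → split (does (k ∣? n))
    where
    split : ∀ t {x y} → (if t then x ℤ.+ y else 0ℤ) ≡ (if t then x else 0ℤ) ℤ.+ (if t then y else 0ℤ)
    split true  = refl
    split false = refl

  dilate-C⊛ : ∀ a f → dilate k (C a ⊛ f) ≈ C a ⊛ dilate k f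
  dilate-C⊛ a f = coefficientwise λ n → trans (split (does (k ∣? n))) (sym (C-⊛ a (dilate k f) n))
    where
    split : ∀ t {m} → (if t then (C a ⊛ f) m else 0ℤ) ≡ a ℤ.* (if t then f m else 0ℤ)
    split true {m} = C-⊛ a f m
    split false    = sym (ℤ.*-zeroʳ a)

dilate-zero : ∀ k f → dilate (suc k) f 0 ≡ f 0
dilate-zero k f rewrite dec-true (suc k ∣? 0) (suc k ℕ.∣0) = cong f (m<n⇒m/n≡0 {0} {suc k} (s≤s z≤n))

dilate-< : ∀ k f n → n < k → dilate (suc k) f (suc n) ≡ 0ℤ
dilate-< k f n n<k rewrite dec-false (suc k ∣? suc n) (λ d → ℕ.<⇒≱ (s≤s n<k) (ℕ.∣⇒≤ d)) = refl

dilate-+ : ∀ k f n → dilate (suc k) f (suc k + n) ≡ dilate (suc k) (f ∘ suc) n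
dilate-+ k f n = cong₂ (if_then_else 0ℤ)
  (does-⇔ (mk⇔ (λ d → ℕ.∣m+n∣m⇒∣n d ℕ.∣-refl) (ℕ.∣m∣n⇒∣m+n ℕ.∣-refl)) (suc k ∣? (suc k + n)) (suc k ∣? n))
  (cong f (trans (m/n≡1+[m∸n]/n {suc k + n} {suc k} (ℕ.m≤m+n (suc k) n))
                 (cong (λ m → suc (m / suc k)) (ℕ.m+n∸m≡n (suc k) n))))

-- Substituting qᵏ in f = f(0) + q t. This is the equation through which `recursion-unique` handles
-- dilations.
dilate-rec : ∀ k .⦃ _ : NonZero k ⦄ f → dilate k f ≈ C (f 0) ⊕ mono k ⊛ dilate k (f ∘ suc)
dilate-rec (suc k) f = coefficientwise at-n
  where
  g = dilate (suc k) (f ∘ suc)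
  at-n : ∀ n → dilate (suc k) f n ≡ C (f 0) n ℤ.+ (mono (suc k) ⊛ g) n
  at-n zero = trans (dilate-zero k f) (sym (trans (cong (λ z → f 0 ℤ.+ z) (ℤ.*-zeroˡ (g 0))) (ℤ.+-identityʳ (f 0))))
  at-n (suc n) with n ℕ.<? k
  ... | yes n<k = trans (dilate-< k f n n<k) (sym (trans (ℤ.+-identityˡ _) (mono-⊛-< g (s≤s n<k))))
  ... | no  n≮k = subst (λ m → dilate (suc k) f m ≡ 0ℤ ℤ.+ (mono (suc k) ⊛ g) m) (ℕ.m+[n∸m]≡n (s≤s (ℕ.≮⇒≥ n≮k)))
    (trans (dilate-+ k f (n ∸ k)) (sym (trans (ℤ.+-identityˡ _) (mono-⊛-+ (suc k) g (n ∸ k)))))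

dilate-C : ∀ k .⦃ _ : NonZero k ⦄ a → dilate k (C a) ≈ C a
dilate-C k a = coefficientwise λ n →
  trans (at (dilate-rec k (C a)) n) (trans (cong (λ z → C a n ℤ.+ z) (vanishing n)) (ℤ.+-identityʳ _))
  where
  branches-agree : ∀ t → (if t then 0ℤ else 0ℤ) ≡ 0ℤ
  branches-agree true  = refl
  branches-agree false = refl
  vanishing : ∀ n → (mono k ⊛ dilate k (λ _ → 0ℤ)) n ≡ 0ℤ
  vanishing n = trans (⊛-comm (mono k) (dilate k (λ _ → 0ℤ)) n)
                      (zero-⊛ (λ i → branches-agree (does (k ∣? i))) (mono k) n)

dilate-X⊛ : ∀ k .⦃ _ : NonZero k ⦄ f → dilate k (X ⊛ f) ≈ mono k ⊛ dilate k f
dilate-X⊛ k f = begin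
  dilate k (X ⊛ f)
    ≈⟨ dilate-rec k (X ⊛ f) ⟩
  C (0ℤ ℤ.* f 0) ⊕ mono k ⊛ dilate k ((X ⊛ f) ∘ suc)
    ≈⟨ R.+-cong (R.reflexive (cong C (ℤ.*-zeroˡ (f 0))))
              (R.*-congˡ (dilate-cong k (coefficientwise (mono-⊛-+ 1 f)))) ⟩
  C 0ℤ ⊕ mono k ⊛ dilate k f
    ≈⟨ R.+-identityˡ _ ⟩
  mono k ⊛ dilate k f ∎

dilate-mono : ∀ k .⦃ _ : NonZero k ⦄ j → dilate k (mono j) ≈ mono (j * k)
dilate-mono k zero    = dilate-C k 1ℤ
dilate-mono k (suc j) = begin
  dilate k (mono (suc j))    ≈⟨ dilate-cong k (mono-+ 1 j) ⟨
  dilate k (X ⊛ mono j)      ≈⟨ dilate-X⊛ k (mono j) ⟩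
  mono k ⊛ dilate k (mono j) ≈⟨ R.*-congˡ (dilate-mono k j) ⟩
  mono k ⊛ mono (j * k)      ≈⟨ mono-+ k (j * k) ⟩
  mono (suc j * k)           ∎

-- For fixed `g`, both sides are solutions Φ of Φ(f) = f(0) g(qᵏ) + qᵏ Φ(t), where t is `f ∘ suc`.
dilate-⊛ : ∀ k .⦃ _ : NonZero k ⦄ f g → dilate k (f ⊛ g) ≈ dilate k f ⊛ dilate k g
dilate-⊛ k@(suc k′) f g = recursion-unique k′ {λ f → dilate k (f ⊛ g)} {λ f → dilate k f ⊛ dilate k g}
  {λ f → C (f 0) ⊛ dilate k g} (_∘ suc) left right f
  where
  left : ∀ f → dilate k (f ⊛ g) ≈ C (f 0) ⊛ dilate k g ⊕ mono k ⊛ dilate k ((f ∘ suc) ⊛ g)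
  left f = begin
    dilate k (f ⊛ g)
      ≈⟨ dilate-cong k (R.*-congʳ (head-tail f)) ⟩
    dilate k ((C (f 0) ⊕ X ⊛ (f ∘ suc)) ⊛ g)
      ≈⟨ dilate-cong k (solve 4 (λ c x t g → (c :+ x :* t) :* g := c :* g :+ x :* (t :* g)) R.refl
           (C (f 0)) (mono 1) (f ∘ suc) g) ⟩
    dilate k (C (f 0) ⊛ g ⊕ X ⊛ ((f ∘ suc) ⊛ g))
      ≈⟨ dilate-⊕ k (C (f 0) ⊛ g) (X ⊛ ((f ∘ suc) ⊛ g)) ⟩
    dilate k (C (f 0) ⊛ g) ⊕ dilate k (X ⊛ ((f ∘ suc) ⊛ g))
      ≈⟨ R.+-cong (dilate-C⊛ k (f 0) g) (dilate-X⊛ k _) ⟩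
    C (f 0) ⊛ dilate k g ⊕ mono k ⊛ dilate k ((f ∘ suc) ⊛ g) ∎
  right : ∀ f → dilate k f ⊛ dilate k g ≈ C (f 0) ⊛ dilate k g ⊕ mono k ⊛ (dilate k (f ∘ suc) ⊛ dilate k g)
  right f = begin
    dilate k f ⊛ dilate k g
      ≈⟨ R.*-congʳ (dilate-rec k f) ⟩
    (C (f 0) ⊕ mono k ⊛ dilate k (f ∘ suc)) ⊛ dilate k g
      ≈⟨ solve 4 (λ c x t g → (c :+ x :* t) :* g := c :* g :+ x :* (t :* g)) R.refl
           (C (f 0)) (mono k) (dilate k (f ∘ suc)) (dilate k g) ⟩
    C (f 0) ⊛ dilate k g ⊕ mono k ⊛ (dilate k (f ∘ suc) ⊛ dilate k g) ∎

-- The exponent is a variable `m` with an equation, so that a product of exponents may be supplied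
-- in either order.
dilate-dilate : ∀ k l m .⦃ _ : NonZero k ⦄ .⦃ _ : NonZero l ⦄ .⦃ _ : NonZero m ⦄ → m ≡ l * k → ∀ f →
                dilate k (dilate l f) ≈ dilate m f
dilate-dilate k@(suc k′) l@(suc l′) m refl = recursion-unique (k′ + l′ * k) {λ f → dilate k (dilate l f)} {dilate m}
  {λ f → C (f 0)} (_∘ suc) left (dilate-rec m)
  where
  left : ∀ f → dilate k (dilate l f) ≈ C (f 0) ⊕ mono m ⊛ dilate k (dilate l (f ∘ suc))
  left f = begin
    dilate k (dilate l f)
      ≈⟨ dilate-cong k (dilate-rec l f) ⟩
    dilate k (C (f 0) ⊕ mono l ⊛ dilate l (f ∘ suc))
      ≈⟨ dilate-⊕ k (C (f 0)) (mono l ⊛ dilate l (f ∘ suc)) ⟩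
    dilate k (C (f 0)) ⊕ dilate k (mono l ⊛ dilate l (f ∘ suc))
      ≈⟨ R.+-cong (dilate-C k (f 0)) (dilate-⊛ k (mono l) _) ⟩
    C (f 0) ⊕ dilate k (mono l) ⊛ dilate k (dilate l (f ∘ suc))
      ≈⟨ R.+-congˡ {C (f 0)} (R.*-congʳ (dilate-mono k l)) ⟩
    C (f 0) ⊕ mono m ⊛ dilate k (dilate l (f ∘ suc)) ∎

-- Euler's identity and Lambert series

-- The series 1 + r q, 1/(1 - r q) and r q/(1 - r q). The ratio r = 0 is allowed and serves for
-- parts that must not occur.
linear geometric geometric⁺ : ℤ → Series
linear r zero          = 1ℤ
linear r (suc zero)    = r
linear r (suc (suc _)) = 0ℤ
geometric r j = r ℤ.^ j
geometric⁺ r = C r ⊛ X ⊛ geometric r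

linear-≈ : ∀ r → linear r ≈ C 1ℤ ⊕ C r ⊛ X
linear-≈ r = begin
  linear r                    ≈⟨ head-tail (linear r) ⟩
  C 1ℤ ⊕ X ⊛ (linear r ∘ suc) ≈⟨ R.+-congˡ {C 1ℤ} (R.*-congˡ (coefficientwise λ { zero → refl ; (suc _) → refl })) ⟩
  C 1ℤ ⊕ X ⊛ C r              ≈⟨ R.+-congˡ {C 1ℤ} (R.*-comm X (C r)) ⟩
  C 1ℤ ⊕ C r ⊛ X              ∎

geometric-rec : ∀ r → geometric r ≈ C 1ℤ ⊕ geometric⁺ r
geometric-rec r = begin
  geometric r
    ≈⟨ head-tail (geometric r) ⟩
  C 1ℤ ⊕ X ⊛ (geometric r ∘ suc)
    ≈⟨ R.+-congˡ {C 1ℤ} (R.*-congˡ (coefficientwise λ n → sym (C-⊛ r (geometric r) n))) ⟩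
  C 1ℤ ⊕ X ⊛ (C r ⊛ geometric r)
    ≈⟨ solve 3 (λ X r g → con 1ℤ :+ X :* (r :* g) := con 1ℤ :+ r :* X :* g) R.refl X (C r) (geometric r) ⟩
  C 1ℤ ⊕ geometric⁺ r ∎

linear⊛geometric : ∀ r → linear r ⊛ geometric (ℤ.- r) ≈ C 1ℤ
linear⊛geometric r = begin
  linear r ⊛ g
    ≈⟨ R.*-congʳ (linear-≈ r) ⟩
  (C 1ℤ ⊕ C r ⊛ X) ⊛ g
    ≈⟨ solve 3 (λ X r g → (con 1ℤ :+ r :* X) :* g := g :+ r :* X :* g) R.refl X (C r) g ⟩
  g ⊕ C r ⊛ X ⊛ g
    ≈⟨ R.+-congʳ {C r ⊛ X ⊛ g} (geometric-rec (ℤ.- r)) ⟩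
  C 1ℤ ⊕ C (ℤ.- r) ⊛ X ⊛ g ⊕ C r ⊛ X ⊛ g
    ≈⟨ R.+-congʳ {C r ⊛ X ⊛ g} (R.+-congˡ {C 1ℤ} (R.*-congʳ (R.*-congʳ (C-⊝ r)))) ⟩
  C 1ℤ ⊕ (⊝ C r) ⊛ X ⊛ g ⊕ C r ⊛ X ⊛ g
    ≈⟨ solve 3 (λ X r g → con 1ℤ :+ (:- r) :* X :* g :+ r :* X :* g := con 1ℤ) R.refl X (C r) g ⟩
  C 1ℤ ∎
  where g = geometric (ℤ.- r)

-- The operator q d/dq. In the factor belonging to one part size, coefficient `j` stands for `j`
-- copies of the part, so the operator counts copies.
X∂ : Series → Series
X∂ f j = + j ℤ.* f j

X∂-linear : ∀ r → X∂ (linear r) ≈ linear r ⊛ (C r ⊛ X ⊛ geometric (ℤ.- r))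
X∂-linear r = begin
  X∂ (linear r)
    ≈⟨ head-tail (X∂ (linear r)) ⟩
  C 0ℤ ⊕ X ⊛ (X∂ (linear r) ∘ suc)
    ≈⟨ R.+-identityˡ _ ⟩
  X ⊛ (X∂ (linear r) ∘ suc)
    ≈⟨ R.*-congˡ (coefficientwise λ
         { zero → ℤ.*-identityˡ r ; (suc n) → ℤ.*-zeroʳ (+ suc (suc n)) }) ⟩
  X ⊛ C r
    ≈⟨ solve 2 (λ X r → X :* r := r :* X :* con 1ℤ) R.refl X (C r) ⟩
  C r ⊛ X ⊛ C 1ℤ
    ≈⟨ R.*-congˡ (linear⊛geometric r) ⟨
  C r ⊛ X ⊛ (linear r ⊛ geometric (ℤ.- r))
    ≈⟨ solve 4 (λ X r l g → r :* X :* (l :* g) := l :* (r :* X :* g)) R.refl X (C r) (linear r) (geometric (ℤ.- r)) ⟩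
  linear r ⊛ (C r ⊛ X ⊛ geometric (ℤ.- r)) ∎

geometric⊛linear : ∀ r → geometric r ⊛ linear (ℤ.- r) ≈ C 1ℤ
geometric⊛linear r = begin
  geometric r ⊛ linear (ℤ.- r)             ≈⟨ R.*-comm (geometric r) (linear (ℤ.- r)) ⟩
  linear (ℤ.- r) ⊛ geometric r             ≡⟨ cong (λ z → linear (ℤ.- r) ⊛ geometric z) (ℤ.neg-involutive r) ⟨
  linear (ℤ.- r) ⊛ geometric (ℤ.- (ℤ.- r)) ≈⟨ linear⊛geometric (ℤ.- r) ⟩
  C 1ℤ                                     ∎

-- Comparing coefficients gives d = r q (g + d), that is (1 - r q) d = r q g. Multiplying by g, the
-- inverse of 1 - r q, isolates d.
X∂-geometric : ∀ r → X∂ (geometric r) ≈ geometric r ⊛ geometric⁺ r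
X∂-geometric r = begin
  d
    ≈⟨ R.*-identityʳ d ⟨
  d ⊛ C 1ℤ
    ≈⟨ R.*-congˡ (geometric⊛linear r) ⟨
  d ⊛ (g ⊛ linear (ℤ.- r))
    ≈⟨ R.*-congˡ (R.*-congˡ (linear-≈ (ℤ.- r))) ⟩
  d ⊛ (g ⊛ (C 1ℤ ⊕ C (ℤ.- r) ⊛ X))
    ≈⟨ R.*-congˡ {d} (R.*-congˡ {g} (R.+-congˡ {C 1ℤ} (R.*-congʳ (C-⊝ r)))) ⟩
  d ⊛ (g ⊛ (C 1ℤ ⊕ ⊝ C r ⊛ X))
    ≈⟨ solve 4 (λ d g r X → d :* (g :* (con 1ℤ :+ (:- r) :* X)) := g :* d :+ :- (g :* r :* X :* d)) R.refl
         d g (C r) X ⟩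
  g ⊛ d ⊕ ⊝ (g ⊛ C r ⊛ X ⊛ d)
    ≈⟨ R.+-congʳ {⊝ (g ⊛ C r ⊛ X ⊛ d)} (R.*-congˡ {g} d-rec) ⟩
  g ⊛ (X ⊛ (C r ⊛ (g ⊕ d))) ⊕ ⊝ (g ⊛ C r ⊛ X ⊛ d)
    ≈⟨ solve 4 (λ d g r X → g :* (X :* (r :* (g :+ d))) :+ :- (g :* r :* X :* d) := g :* (r :* X :* g)) R.refl
         d g (C r) X ⟩
  g ⊛ geometric⁺ r ∎
  where
  g = geometric r
  d = X∂ (geometric r)
  rearrange : ∀ j r y → (1ℤ ℤ.+ j) ℤ.* (r ℤ.* y) ≡ r ℤ.* (y ℤ.+ j ℤ.* y)
  rearrange = solve-∀
  d-rec : d ≈ X ⊛ (C r ⊛ (g ⊕ d))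
  d-rec = begin
    d
      ≈⟨ head-tail d ⟩
    C 0ℤ ⊕ X ⊛ (d ∘ suc)
      ≈⟨ R.+-identityˡ _ ⟩
    X ⊛ (d ∘ suc)
      ≈⟨ R.*-congˡ (coefficientwise λ n → trans (rearrange (+ n) r (r ℤ.^ n)) (sym (C-⊛ r (g ⊕ d) n))) ⟩
    X ⊛ (C r ⊛ (g ⊕ d)) ∎

dilate-linear : ∀ k .⦃ _ : NonZero k ⦄ r → dilate k (linear r) ≈ C 1ℤ ⊕ C r ⊛ mono k
dilate-linear k r = begin
  dilate k (linear r)
    ≈⟨ dilate-cong k (linear-≈ r) ⟩
  dilate k (C 1ℤ ⊕ C r ⊛ X)
    ≈⟨ dilate-⊕ k (C 1ℤ) (C r ⊛ X) ⟩
  dilate k (C 1ℤ) ⊕ dilate k (C r ⊛ X)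
    ≈⟨ R.+-cong (dilate-C k 1ℤ) (R.trans (dilate-C⊛ k r X)
                         (R.*-congˡ (R.trans (dilate-mono k 1) (R.reflexive (cong mono (ℕ.*-identityˡ k)))))) ⟩
  C 1ℤ ⊕ C r ⊛ mono k ∎

linear⊛linear : linear -1ℤ ⊛ linear 1ℤ ≈ dilate 2 (linear -1ℤ)
linear⊛linear = begin
  linear -1ℤ ⊛ linear 1ℤ
    ≈⟨ R.*-cong (linear-≈ -1ℤ) (linear-≈ 1ℤ) ⟩
  (C 1ℤ ⊕ C -1ℤ ⊛ X) ⊛ (C 1ℤ ⊕ C 1ℤ ⊛ X)
    ≈⟨ solve 1 (λ X → (con 1ℤ :+ con -1ℤ :* X) :* (con 1ℤ :+ con 1ℤ :* X) := con 1ℤ :+ con -1ℤ :* (X :* X)) R.refl X ⟩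
  C 1ℤ ⊕ C -1ℤ ⊛ (X ⊛ X)
    ≈⟨ R.+-congˡ {C 1ℤ} (R.*-congˡ (mono-+ 1 1)) ⟩
  C 1ℤ ⊕ C -1ℤ ⊛ mono 2
    ≈⟨ dilate-linear 2 -1ℤ ⟨
  dilate 2 (linear -1ℤ) ∎

-- Over the common denominator 1 - q² this is q (1 - q) + 2 q² = q (1 + q).
geometric⁺-alternating : C 1ℤ ⊛ X ⊛ geometric -1ℤ ⊕ C (+ 2) ⊛ dilate 2 (geometric⁺ 1ℤ) ≈ geometric⁺ 1ℤ
geometric⁺-alternating = begin
  C 1ℤ ⊛ X ⊛ h ⊕ C (+ 2) ⊛ dilate 2 (geometric⁺ 1ℤ)
    ≈⟨ R.+-congˡ {C 1ℤ ⊛ X ⊛ h} (R.*-congˡ dilated) ⟩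
  C 1ℤ ⊛ X ⊛ h ⊕ C (+ 2) ⊛ (X ⊛ X ⊛ (g ⊛ h))
    ≈⟨ solve 3 (λ X g h → con 1ℤ :* X :* h :+ con (+ 2) :* (X :* X :* (g :* h))
         := X :* h :* (con 1ℤ :+ con (+ 2) :* X :* g)) R.refl X g h ⟩
  X ⊛ h ⊛ (C 1ℤ ⊕ C (+ 2) ⊛ X ⊛ g)
    ≈⟨ R.*-congˡ {X ⊛ h} (R.+-congʳ {C (+ 2) ⊛ X ⊛ g} (geometric⊛linear 1ℤ)) ⟨
  X ⊛ h ⊛ (g ⊛ linear -1ℤ ⊕ C (+ 2) ⊛ X ⊛ g)
    ≈⟨ R.*-congˡ {X ⊛ h} (R.+-congʳ {C (+ 2) ⊛ X ⊛ g} (R.*-congˡ {g} (linear-≈ -1ℤ))) ⟩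
  X ⊛ h ⊛ (g ⊛ (C 1ℤ ⊕ C -1ℤ ⊛ X) ⊕ C (+ 2) ⊛ X ⊛ g)
    ≈⟨ solve 3 (λ X g h → X :* h :* (g :* (con 1ℤ :+ con -1ℤ :* X) :+ con (+ 2) :* X :* g)
       := X :* g :* ((con 1ℤ :+ con 1ℤ :* X) :* h)) R.refl X g h ⟩
  X ⊛ g ⊛ ((C 1ℤ ⊕ C 1ℤ ⊛ X) ⊛ h)
    ≈⟨ R.*-congˡ {X ⊛ g} (R.*-congʳ {h} (linear-≈ 1ℤ)) ⟨
  X ⊛ g ⊛ (linear 1ℤ ⊛ h)
    ≈⟨ R.*-congˡ {X ⊛ g} (linear⊛geometric 1ℤ) ⟩
  X ⊛ g ⊛ C 1ℤ
    ≈⟨ solve 2 (λ X g → X :* g :* con 1ℤ := con 1ℤ :* X :* g) R.refl X g ⟩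
  geometric⁺ 1ℤ ∎
  where
  g h g₂ : Series
  g  = geometric 1ℤ
  h  = geometric -1ℤ
  g₂ = dilate 2 g
  -- This is 1/(1 - q²) = 1/(1 - q) · 1/(1 + q): the products g (1 - q) and (1 + q) h, both equal to
  -- 1, are inserted, and then `g₂` cancels against (1 - q)(1 + q) = 1 - q².
  g₂≈gh : g₂ ≈ g ⊛ h
  g₂≈gh = begin
    g₂
      ≈⟨ solve 1 (λ g₂ → g₂ := g₂ :* (con 1ℤ :* con 1ℤ)) R.refl g₂ ⟩
    g₂ ⊛ (C 1ℤ ⊛ C 1ℤ)
      ≈⟨ R.*-congˡ {g₂} (R.*-cong (geometric⊛linear 1ℤ) (linear⊛geometric 1ℤ)) ⟨
    g₂ ⊛ (g ⊛ linear -1ℤ ⊛ (linear 1ℤ ⊛ h))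
      ≈⟨ solve 5 (λ g₂ g h a b → g₂ :* (g :* a :* (b :* h)) := g₂ :* (a :* b) :* (g :* h)) R.refl
           g₂ g h (linear -1ℤ) (linear 1ℤ) ⟩
    g₂ ⊛ (linear -1ℤ ⊛ linear 1ℤ) ⊛ (g ⊛ h)
      ≈⟨ R.*-congʳ {g ⊛ h} (R.*-congˡ {g₂} linear⊛linear) ⟩
    g₂ ⊛ dilate 2 (linear -1ℤ) ⊛ (g ⊛ h)
      ≈⟨ R.*-congʳ {g ⊛ h} (dilate-⊛ 2 g (linear -1ℤ)) ⟨
    dilate 2 (g ⊛ linear -1ℤ) ⊛ (g ⊛ h)
      ≈⟨ R.*-congʳ {g ⊛ h} (R.trans (dilate-cong 2 (geometric⊛linear 1ℤ)) (dilate-C 2 1ℤ)) ⟩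
    C 1ℤ ⊛ (g ⊛ h)
      ≈⟨ R.*-identityˡ _ ⟩
    g ⊛ h ∎
  dilated : dilate 2 (geometric⁺ 1ℤ) ≈ X ⊛ X ⊛ (g ⊛ h)
  dilated = begin
    dilate 2 (C 1ℤ ⊛ X ⊛ g) ≈⟨ dilate-cong 2 (R.*-congʳ {g} (R.*-identityˡ X)) ⟩
    dilate 2 (X ⊛ g)        ≈⟨ dilate-X⊛ 2 g ⟩
    mono 2 ⊛ g₂             ≈⟨ R.*-cong (R.sym (mono-+ 1 1)) g₂≈gh ⟩
    X ⊛ X ⊛ (g ⊛ h)         ∎

-- Finite products and sums over the part sizes

∏ ∑ : (ℕ → Series) → ℕ → Series
∏ F zero    = C 1ℤ
∏ F (suc m) = F m ⊛ ∏ F m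
∑ F zero    = C 0ℤ
∑ F (suc m) = F m ⊕ ∑ F m

-- Used as the ratio of a geometric series: ratio 0 leaves the factor 1, so even parts are excluded
-- without a separate kind of factor.
χ : ℕ → ℤ
χ i = if does (2 ∣? i) then 0ℤ else 1ℤ

-- Index m belongs to the part m + 1: these are 1 - q^(m+1), 1 + q^(m+1), and
-- 1/(1 - q^(m+1)) for m + 1 odd, 1 for m + 1 even.
[q] [-q] oddGeometric : ℕ → Series
[q]  m         = dilate (suc m) (linear -1ℤ)
[-q] m         = dilate (suc m) (linear 1ℤ)
oddGeometric m = dilate (suc m) (geometric (χ (suc m)))

dilate-swap : ∀ m f → dilate (suc m) (dilate 2 f) ≈ dilate 2 (dilate (suc m) f)
dilate-swap m f = R.trans (dilate-dilate (suc m) 2 (2 * suc m) refl f)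
                          (R.sym (dilate-dilate 2 (suc m) (2 * suc m) (ℕ.*-comm 2 (suc m)) f))

-- The two halves of Euler's identity ∏ (1 + qⁱ) = ∏ 1/(1 - q²ⁱ⁻¹).
euler-distinct : ∀ m → ∏ [q] m ⊛ ∏ [-q] m ≈ dilate 2 (∏ [q] m)
euler-distinct zero    = R.trans (R.*-identityˡ (C 1ℤ)) (R.sym (dilate-C 2 1ℤ))
euler-distinct (suc m) = begin
  [q] m ⊛ ∏ [q] m ⊛ ([-q] m ⊛ ∏ [-q] m)
    ≈⟨ solve 4 (λ a b c d → a :* b :* (c :* d) := a :* c :* (b :* d)) R.refl ([q] m) (∏ [q] m) ([-q] m) (∏ [-q] m) ⟩
  [q] m ⊛ [-q] m ⊛ (∏ [q] m ⊛ ∏ [-q] m)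
    ≈⟨ R.*-cong factor (euler-distinct m) ⟩
  dilate 2 ([q] m) ⊛ dilate 2 (∏ [q] m)
    ≈⟨ dilate-⊛ 2 ([q] m) (∏ [q] m) ⟨
  dilate 2 (∏ [q] (suc m)) ∎
  where
  factor : [q] m ⊛ [-q] m ≈ dilate 2 ([q] m)
  factor = R.trans (R.sym (dilate-⊛ (suc m) (linear -1ℤ) (linear 1ℤ)))
             (R.trans (dilate-cong (suc m) linear⊛linear) (dilate-swap m (linear -1ℤ)))

2∤1+m*2 : ∀ m → 2 ∤ suc (m * 2)
2∤1+m*2 m 2∣ = ℕ.1+n≰n (ℕ.∣⇒≤ (ℕ.∣m+n∣m⇒∣n (subst (2 ∣_) (ℕ.+-comm 1 (m * 2)) 2∣) (divides m refl)))

χ-odd : ∀ m → χ (suc (m * 2)) ≡ 1ℤ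
χ-odd m rewrite dec-false (2 ∣? suc (m * 2)) (2∤1+m*2 m) = refl

χ-even : ∀ m → χ (m * 2) ≡ 0ℤ
χ-even m rewrite dec-true (2 ∣? (m * 2)) (divides m refl) = refl

geometric⁺-0 : geometric⁺ 0ℤ ≈ C 0ℤ
geometric⁺-0 = solve 2 (λ X g → con 0ℤ :* X :* g := con 0ℤ) R.refl X (geometric 0ℤ)

geometric-0 : geometric 0ℤ ≈ C 1ℤ
geometric-0 = R.trans (geometric-rec 0ℤ) (R.trans (R.+-congˡ {C 1ℤ} geometric⁺-0) (R.+-identityʳ (C 1ℤ)))

[q]⊛oddGeometric : ∀ m → [q] (m * 2) ⊛ oddGeometric (m * 2) ≈ C 1ℤ
[q]⊛oddGeometric m rewrite χ-odd m = R.trans (R.sym (dilate-⊛ i (linear -1ℤ) (geometric 1ℤ)))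
  (R.trans (dilate-cong i (linear⊛geometric -1ℤ)) (dilate-C i 1ℤ))
  where i = suc (m * 2)

oddGeometric-even : ∀ m → oddGeometric (suc (m * 2)) ≈ C 1ℤ
oddGeometric-even m rewrite χ-even (suc m) = R.trans (dilate-cong (suc m * 2) geometric-0) (dilate-C (suc m * 2) 1ℤ)

euler-odd : ∀ m → ∏ [q] (m * 2) ⊛ ∏ oddGeometric (m * 2) ≈ dilate 2 (∏ [q] m)
euler-odd zero    = R.trans (R.*-identityˡ (C 1ℤ)) (R.sym (dilate-C 2 1ℤ))
euler-odd (suc m) = begin
  -- Two part sizes are added at a time. For the odd size 2m + 1 the factors `e` and `g` cancel; for
  -- the even size 2m + 2 the factor `g′` is 1, and `e′` is the next factor of the product at q².
  e′ ⊛ (e ⊛ ∏ [q] n) ⊛ (g′ ⊛ (g ⊛ ∏ oddGeometric n))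
    ≈⟨ solve 6 (λ e′ e p g′ g o → e′ :* (e :* p) :* (g′ :* (g :* o)) := g′ :* ((e :* g) :* (e′ :* (p :* o)))) R.refl
         e′ e (∏ [q] n) g′ g (∏ oddGeometric n) ⟩
  g′ ⊛ ((e ⊛ g) ⊛ (e′ ⊛ (∏ [q] n ⊛ ∏ oddGeometric n)))
    ≈⟨ R.*-cong (oddGeometric-even m)
                (R.*-cong ([q]⊛oddGeometric m) (R.*-cong (R.sym (dilate-dilate 2 (suc m) (suc m * 2) refl (linear -1ℤ))) (euler-odd m))) ⟩
  C 1ℤ ⊛ (C 1ℤ ⊛ (dilate 2 ([q] m) ⊛ dilate 2 (∏ [q] m)))
    ≈⟨ R.trans (R.*-identityˡ _) (R.*-identityˡ _) ⟩
  dilate 2 ([q] m) ⊛ dilate 2 (∏ [q] m)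
    ≈⟨ dilate-⊛ 2 ([q] m) (∏ [q] m) ⟨
  dilate 2 (∏ [q] (suc m)) ∎
  where
  n = m * 2
  e = [q] n
  e′ = [q] (suc n)
  g = oddGeometric n
  g′ = oddGeometric (suc n)

-- With i = m + 1 these are qⁱ/(1 - qⁱ), its restriction to odd i, and qⁱ/(1 + qⁱ). The factor
-- `C 1ℤ` in the last keeps it literally the case r = 1 of `Distinct.logFactor`.
lambert lambertOdd lambertAlternating : ℕ → Series
lambert            m = dilate (suc m) (geometric⁺ 1ℤ)
lambertOdd         m = dilate (suc m) (geometric⁺ (χ (suc m)))
lambertAlternating m = dilate (suc m) (C 1ℤ ⊛ X ⊛ geometric -1ℤ)

∑-lambert-alternating : ∀ m → ∑ lambertAlternating m ⊕ C (+ 2) ⊛ dilate 2 (∑ lambert m) ≈ ∑ lambert m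
∑-lambert-alternating zero    = R.trans (R.+-identityˡ _) (R.trans (R.*-congˡ (dilate-C 2 0ℤ)) (R.zeroʳ (C (+ 2))))
∑-lambert-alternating (suc m) = begin
  a ⊕ A ⊕ C (+ 2) ⊛ dilate 2 (l ⊕ L)
    ≈⟨ R.+-congˡ {a ⊕ A} (R.*-congˡ {C (+ 2)} (dilate-⊕ 2 l L)) ⟩
  a ⊕ A ⊕ C (+ 2) ⊛ (dilate 2 l ⊕ dilate 2 L)
    ≈⟨ solve 4 (λ a A l L → a :+ A :+ con (+ 2) :* (l :+ L) := (a :+ con (+ 2) :* l) :+ (A :+ con (+ 2) :* L)) R.refl
         a A (dilate 2 l) (dilate 2 L) ⟩
  (a ⊕ C (+ 2) ⊛ dilate 2 l) ⊕ (A ⊕ C (+ 2) ⊛ dilate 2 L)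
    ≈⟨ R.+-cong factor (∑-lambert-alternating m) ⟩
  l ⊕ L ∎
  where
  a = lambertAlternating m
  A = ∑ lambertAlternating m
  l = lambert m
  L = ∑ lambert m
  i = suc m
  factor : a ⊕ C (+ 2) ⊛ dilate 2 l ≈ l
  factor = begin
    a ⊕ C (+ 2) ⊛ dilate 2 l
      ≈⟨ R.+-congˡ {a} (R.*-congˡ (dilate-swap m (geometric⁺ 1ℤ))) ⟨
    a ⊕ C (+ 2) ⊛ dilate i (dilate 2 (geometric⁺ 1ℤ))
      ≈⟨ R.+-congˡ {a} (dilate-C⊛ i (+ 2) (dilate 2 (geometric⁺ 1ℤ))) ⟨
    a ⊕ dilate i (C (+ 2) ⊛ dilate 2 (geometric⁺ 1ℤ))
      ≈⟨ dilate-⊕ i (C 1ℤ ⊛ X ⊛ geometric -1ℤ) (C (+ 2) ⊛ dilate 2 (geometric⁺ 1ℤ)) ⟨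
    dilate i (C 1ℤ ⊛ X ⊛ geometric -1ℤ ⊕ C (+ 2) ⊛ dilate 2 (geometric⁺ 1ℤ))
      ≈⟨ dilate-cong i geometric⁺-alternating ⟩
    l ∎

-- The terms of even index 2i are the terms of index i at q², so `m` dilated terms fill the gaps
-- among 2m.
∑-lambert-odd : ∀ m → ∑ lambertOdd (m * 2) ⊕ dilate 2 (∑ lambert m) ≈ ∑ lambert (m * 2)
∑-lambert-odd zero    = R.trans (R.+-identityˡ _) (dilate-C 2 0ℤ)
∑-lambert-odd (suc m) = begin
  o′ ⊕ (o ⊕ O) ⊕ dilate 2 (l ⊕ ∑ lambert m)
    ≈⟨ R.+-congˡ {o′ ⊕ (o ⊕ O)} (dilate-⊕ 2 l (∑ lambert m)) ⟩
  o′ ⊕ (o ⊕ O) ⊕ (dilate 2 l ⊕ dilate 2 (∑ lambert m))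
    ≈⟨ solve 5 (λ o′ o O l L → o′ :+ (o :+ O) :+ (l :+ L) := (o′ :+ l) :+ (o :+ (O :+ L))) R.refl
         o′ o O (dilate 2 l) (dilate 2 (∑ lambert m)) ⟩
  (o′ ⊕ dilate 2 l) ⊕ (o ⊕ (O ⊕ dilate 2 (∑ lambert m)))
    ≈⟨ R.+-cong even (R.+-cong odd (∑-lambert-odd m)) ⟩
  lambert (suc n) ⊕ (lambert n ⊕ ∑ lambert n) ∎
  where
  n = m * 2
  o = lambertOdd n
  o′ = lambertOdd (suc n)
  O = ∑ lambertOdd n
  l = lambert m
  odd : o ≈ lambert n
  odd = R.reflexive (cong (λ r → dilate (suc n) (geometric⁺ r)) (χ-odd m))
  even : o′ ⊕ dilate 2 l ≈ lambert (suc n)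
  even = begin
    o′ ⊕ dilate 2 l
      ≡⟨ cong (λ r → dilate (suc m * 2) (geometric⁺ r) ⊕ dilate 2 l) (χ-even (suc m)) ⟩
    dilate (suc m * 2) (geometric⁺ 0ℤ) ⊕ dilate 2 l
      ≈⟨ R.+-cong (R.trans (dilate-cong (suc m * 2) geometric⁺-0) (dilate-C (suc m * 2) 0ℤ))
                  (dilate-dilate 2 (suc m) (suc m * 2) refl (geometric⁺ 1ℤ)) ⟩
    C 0ℤ ⊕ lambert (suc n)
      ≈⟨ R.+-identityˡ _ ⟩
    lambert (suc n) ∎

-- The pentagonal number theorem

triangular : ℕ → ℕ
triangular zero    = 0
triangular (suc n) = triangular n + suc n

-- Horner's form of Shanks' sum
--   ∑_{r ≤ s} (-1)ʳ (1 - q^(r+1)) ⋯ (1 - q^s) q^(kr + r(r+1)/2),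
-- which for s = k is both ∑_{|j| ≤ k} (-1)ʲ q^(j(3j-1)/2) (a telescoping sum, by
-- shanks-shift) and congruent to (1 - q) ⋯ (1 - q^k) modulo q^(k+1).
shanks : ℕ → ℕ → Series
shanks k zero    = C 1ℤ
shanks k (suc s) = [q] s ⊛ shanks k s ⊕ C (-1ℤ ℤ.^ suc s) ⊛ mono (k * suc s + triangular (suc s))

-- Multiplying by 1 - q^(k+1) lowers the parameter from k + 1 to k at the price of a single boundary
-- monomial, which each step of the induction on `s` pushes one place further.
shanks-shift : ∀ k s → [q] k ⊛ shanks (suc k) s ≈ shanks k s ⊕ C (-1ℤ ℤ.^ suc s) ⊛ mono (suc k * suc s + triangular s)
shanks-shift k zero = begin
  [q] k ⊛ C 1ℤ                        ≈⟨ R.*-identityʳ ([q] k) ⟩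
  [q] k                               ≈⟨ dilate-linear (suc k) -1ℤ ⟩
  C 1ℤ ⊕ C -1ℤ ⊛ mono (suc k)         ≡⟨ cong (λ i → C 1ℤ ⊕ C -1ℤ ⊛ mono i) (exponent k) ⟩
  C 1ℤ ⊕ C -1ℤ ⊛ mono (suc k * 1 + 0) ∎
  where
  exponent : ∀ k → 1 + k ≡ (1 + k) * 1 + 0
  exponent = ℕ-solve-∀
shanks-shift k (suc s) = begin
  [q] k ⊛ ([q] s ⊛ shanks (suc k) s ⊕ e ⊛ mono (suc k * suc s + triangular (suc s)))
    ≈⟨ R.*-congˡ {[q] k} (R.+-congˡ {[q] s ⊛ shanks (suc k) s} (R.*-congˡ {e} uv)) ⟩
  [q] k ⊛ ([q] s ⊛ shanks (suc k) s ⊕ e ⊛ (u ⊛ v))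
    ≈⟨ solve 6 (λ a b c e u v → a :* (b :* c :+ e :* (u :* v)) := b :* (a :* c) :+ a :* (e :* (u :* v))) R.refl
         ([q] k) ([q] s) (shanks (suc k) s) e u v ⟩
  [q] s ⊛ ([q] k ⊛ shanks (suc k) s) ⊕ [q] k ⊛ (e ⊛ (u ⊛ v))
    ≈⟨ R.+-cong (R.*-congˡ {[q] s} (shanks-shift k s)) (R.*-congʳ {e ⊛ (u ⊛ v)} (dilate-linear (suc k) -1ℤ)) ⟩
  [q] s ⊛ (shanks k s ⊕ e ⊛ u) ⊕ (C 1ℤ ⊕ C -1ℤ ⊛ w) ⊛ (e ⊛ (u ⊛ v))
    ≈⟨ solve 6 (λ b c e u v w → b :* (c :+ e :* u) :+ (con 1ℤ :+ con -1ℤ :* w) :* (e :* (u :* v))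
                             := b :* c :+ (b :* (e :* u) :+ (con 1ℤ :+ con -1ℤ :* w) :* (e :* (u :* v)))) R.refl
               ([q] s) (shanks k s) e u v w ⟩
  [q] s ⊛ shanks k s ⊕ ([q] s ⊛ (e ⊛ u) ⊕ (C 1ℤ ⊕ C -1ℤ ⊛ w) ⊛ (e ⊛ (u ⊛ v)))
    ≈⟨ R.+-congˡ {[q] s ⊛ shanks k s}
                  (R.+-congʳ {(C 1ℤ ⊕ C -1ℤ ⊛ w) ⊛ (e ⊛ (u ⊛ v))} (R.*-congʳ {e ⊛ u} (dilate-linear (suc s) -1ℤ))) ⟩
  [q] s ⊛ shanks k s ⊕ ((C 1ℤ ⊕ C -1ℤ ⊛ v) ⊛ (e ⊛ u) ⊕ (C 1ℤ ⊕ C -1ℤ ⊛ w) ⊛ (e ⊛ (u ⊛ v)))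
    -- The identity is (1 - v) u + (1 - w) u v = u - u v w. Here `u` supplies the last summand of
    -- `shanks k (suc s)`, and -u v w is the next boundary monomial.
    ≈⟨ solve 5 (λ p e u v w → p :+ ((con 1ℤ :+ con -1ℤ :* v) :* (e :* u) :+ (con 1ℤ :+ con -1ℤ :* w) :* (e :* (u :* v)))
                           := (p :+ e :* u) :+ (con -1ℤ :* e) :* (u :* v :* w)) R.refl ([q] s ⊛ shanks k s) e u v w ⟩
  ([q] s ⊛ shanks k s ⊕ e ⊛ u) ⊕ (C -1ℤ ⊛ e) ⊛ (u ⊛ v ⊛ w)
    ≈⟨ R.+-cong (R.+-congˡ {[q] s ⊛ shanks k s}
                  (R.*-congˡ {e} (R.reflexive (cong mono (exponent₁ k s (triangular s))))))
                (R.*-cong (coefficientwise λ n → trans (C-⊛ -1ℤ e n) (sign-suc n)) uvw) ⟩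
  shanks k (suc s) ⊕ C (-1ℤ ℤ.^ (2 + s)) ⊛ mono (suc k * (2 + s) + triangular (suc s)) ∎
  where
  e u v w : Series
  e = C (-1ℤ ℤ.^ suc s)
  u = mono (suc k * suc s + triangular s)
  v = mono (suc s)
  w = mono (suc k)
  exponent₁ : ∀ k s t → (1 + k) * (1 + s) + t ≡ k * (1 + s) + (t + (1 + s))
  exponent₁ = ℕ-solve-∀
  exponent₂ : ∀ k s t → (1 + k) * (1 + s) + t + (1 + s) + (1 + k) ≡ (1 + k) * (2 + s) + (t + (1 + s))
  exponent₂ = ℕ-solve-∀
  uv : mono (suc k * suc s + triangular (suc s)) ≈ u ⊛ v
  uv = R.trans (R.reflexive (cong mono (sym (ℕ.+-assoc (suc k * suc s) (triangular s) (suc s)))))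
               (R.sym (mono-+ (suc k * suc s + triangular s) (suc s)))
  uvw : u ⊛ v ⊛ w ≈ mono (suc k * (2 + s) + triangular (suc s))
  uvw = R.trans (R.*-congʳ {w} (mono-+ (suc k * suc s + triangular s) (suc s)))
         (R.trans (mono-+ (suc k * suc s + triangular s + suc s) (suc k))
                  (R.reflexive (cong mono (exponent₂ k s (triangular s)))))
  sign-suc : ∀ n → -1ℤ ℤ.* e n ≡ C (-1ℤ ℤ.^ (2 + s)) n
  sign-suc zero    = refl
  sign-suc (suc n) = refl

-- One new monomial is the boundary term of `shanks-shift`, the other the last Horner step. They
-- belong to the indices n + 1 and -(n + 1), in the order of `window`.
shanks-suc : ∀ n → shanks (suc n) (suc n) ≈
             C (-1ℤ ℤ.^ suc n) ⊛ mono (suc n * suc n + triangular n) ⊕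
             (C (-1ℤ ℤ.^ suc n) ⊛ mono (suc n * suc n + triangular (suc n)) ⊕ shanks n n)
shanks-suc n = R.trans (R.+-congʳ {y} (shanks-shift n n))
  (solve 3 (λ a x y → a :+ x :+ y := x :+ (y :+ a)) R.refl
           (shanks n n) (C (-1ℤ ℤ.^ suc n) ⊛ mono (suc n * suc n + triangular n)) y)
  where y = C (-1ℤ ℤ.^ suc n) ⊛ mono (suc n * suc n + triangular (suc n))

mono-< : ∀ {k i} → i < k → mono k i ≡ 0ℤ
mono-< {suc k} {zero}  _         = refl
mono-< {suc k} {suc i} (s≤s i<k) = mono-< i<k

-- Each monomial added in Horner's scheme has exponent n (s + 1) + (s + 1)(s + 2)/2 > n, so up to
-- coefficient `n` only the product is seen.
shanks-≤ : ∀ n s {i} → i ≤ n → shanks n s i ≡ ∏ [q] s i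
shanks-≤ n zero    i≤n = refl
shanks-≤ n (suc s) {i} i≤n = trans
  (cong₂ ℤ._+_ (⊛-cong-≤ i {[q] s} (λ _ → refl) (λ j≤i → shanks-≤ n s (ℕ.≤-trans j≤i i≤n)))
               (trans (C-⊛ e (mono K) i) (trans (cong (e ℤ.*_) (mono-< i<K)) (ℤ.*-zeroʳ e))))
  (ℤ.+-identityʳ _)
  where
  e = -1ℤ ℤ.^ suc s
  K = n * suc s + triangular (suc s)
  i<K : i < K
  i<K = ℕ.≤-<-trans (ℕ.≤-trans i≤n (ℕ.m≤m*n n (suc s)))
                    (ℕ.m<m+n (n * suc s) (ℕ.≤-trans (s≤s z≤n) (ℕ.m≤n+m (suc s) (triangular s))))

∏[q]-≤ : ∀ {i m n} → i ≤ m → m ≤ n → ∏ [q] n i ≡ ∏ [q] m i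
∏[q]-≤ {i} {m} {n} i≤m m≤n with ℕ.m≤n⇒m<n∨m≡n m≤n
∏[q]-≤ {i} {m} {n}     i≤m m≤n | inj₂ refl      = refl
∏[q]-≤ {i} {m} {suc n} i≤m m≤n | inj₁ (s≤s m≤n′) = trans step (∏[q]-≤ i≤m m≤n′)
  where
  P = ∏ [q] n
  expand : [q] n ⊛ P ≈ P ⊕ C -1ℤ ⊛ (mono (suc n) ⊛ P)
  expand = R.trans (R.*-congʳ {P} (dilate-linear (suc n) -1ℤ))
    (solve 2 (λ m p → (con 1ℤ :+ con -1ℤ :* m) :* p := p :+ con -1ℤ :* (m :* p)) R.refl (mono (suc n)) P)
  step : ([q] n ⊛ P) i ≡ P i
  step = trans (at expand i) (trans
    (cong (λ z → P i ℤ.+ z) (trans (C-⊛ -1ℤ (mono (suc n) ⊛ P) i)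
                                   (cong (-1ℤ ℤ.*_) (mono-⊛-< P (s≤s (ℕ.≤-trans i≤m m≤n′))))))
    (ℤ.+-identityʳ _))

-- Pentagonal numbers and the sum over k

triangular*2 : ∀ n → triangular n * 2 ≡ n * suc n
triangular*2 zero    = refl
triangular*2 (suc n) = trans (ℕ.*-distribʳ-+ 2 (triangular n) (suc n))
                             (trans (cong (_+ suc n * 2) (triangular*2 n)) (expand n))
  where
  expand : ∀ n → n * (1 + n) + (1 + n) * 2 ≡ (1 + n) * (2 + n)
  expand = ℕ-solve-∀

half : ∀ {i} p → i ≡ + (p * 2) → i /ℕ 2 ≡ + p
half p refl = cong +_ (m*n/n≡m p 2)

square+-*2 : ∀ a t m n → t * 2 ≡ m * n → + ((a * a + t) * 2) ≡ + a ℤ.* + a ℤ.* + 2 ℤ.+ + m ℤ.* + n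
square+-*2 a t m n eq = trans
  (cong +_ (trans (ℕ.*-distribʳ-+ 2 (a * a) t) (cong (λ u → a * a * 2 + u) eq)))
  (trans (ℤ.pos-+ (a * a * 2) (m * n))
         (cong₂ ℤ._+_ (trans (ℤ.pos-* (a * a) 2) (cong (ℤ._* + 2) (ℤ.pos-* a a))) (ℤ.pos-* m n)))

-- Splitting k(3k - 1)/2 as k² + k(k - 1)/2 turns the second summand into a triangular number: that
-- of n for k = n + 1, and that of n + 1 for k = -(n + 1).
pentagonal-+ : ∀ n → pentagonal (+ suc n) ≡ + (suc n * suc n + triangular n)
pentagonal-+ n = half (suc n * suc n + triangular n)
  (trans (expand (+ n)) (sym (square+-*2 (suc n) (triangular n) n (suc n) (triangular*2 n))))
  where
  expand : ∀ m → (1ℤ ℤ.+ m) ℤ.* (+ 3 ℤ.* (1ℤ ℤ.+ m) ℤ.- 1ℤ) ≡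
                 (1ℤ ℤ.+ m) ℤ.* (1ℤ ℤ.+ m) ℤ.* + 2 ℤ.+ m ℤ.* (1ℤ ℤ.+ m)
  expand = solve-∀

pentagonal-- : ∀ n → pentagonal -[1+ n ] ≡ + (suc n * suc n + triangular (suc n))
pentagonal-- n = half (suc n * suc n + triangular (suc n))
  (trans (expand (+ suc n)) (sym (square+-*2 (suc n) (triangular (suc n)) (suc n) (2 + n) (triangular*2 (suc n)))))
  where
  expand : ∀ m → (ℤ.- m) ℤ.* (+ 3 ℤ.* (ℤ.- m) ℤ.- 1ℤ) ≡ m ℤ.* m ℤ.* + 2 ℤ.+ m ℤ.* (1ℤ ℤ.+ m)
  expand = solve-∀

bSeries : Series
bSeries n = b (+ n)

-- The convention that `b` vanishes at negative arguments is exactly what makes this hold for p > N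
-- as well.
b-⊖ : ∀ N p → b (+ N ℤ.- + p) ≡ (mono p ⊛ bSeries) N
b-⊖ N p = trans (cong b (ℤ.m-n≡m⊖n N p)) split
  where
  b-negative : ∀ d → 0 < d → b (ℤ.- + d) ≡ 0ℤ
  b-negative (suc d) _ = refl
  split : b (N ℤ.⊖ p) ≡ (mono p ⊛ bSeries) N
  split with p ℕ.≤? N
  ... | yes p≤N = trans (cong b (ℤ.⊖-≥ p≤N)) (sym (mono-⊛-≥ bSeries p≤N))
  ... | no  p≰N = trans (cong b (ℤ.⊖-< (ℕ.≰⇒> p≰N)))
                        (trans (b-negative (p ∸ N) (ℕ.m<n⇒0<n∸m (ℕ.≰⇒> p≰N))) (sym (mono-⊛-< bSeries (ℕ.≰⇒> p≰N))))

window : ℕ → List ℤ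
window zero    = + 0 ∷ []
window (suc n) = + suc n ∷ -[1+ n ] ∷ window n

window-≤ : ∀ n → All (λ k → ℤ.∣ k ∣ ≤ n) (window n)
window-≤ zero    = z≤n ∷ []
window-≤ (suc n) = ℕ.≤-refl ∷ ℕ.≤-refl ∷ All.map ℕ.m≤n⇒m≤1+n (window-≤ n)

window-unique : ∀ n → Unique (window n)
window-unique zero    = [] ∷ []
window-unique (suc n) =
  ((λ ()) ∷ All.map (λ { k≤n refl → ℕ.1+n≰n k≤n }) (window-≤ n)) ∷
  All.map (λ { k≤n refl → ℕ.1+n≰n k≤n }) (window-≤ n) ∷ window-unique n

∈-window : ∀ n k → ℤ.∣ k ∣ ≤ n → k ∈ window n
∈-window zero    (+ zero)  _ = here refl
∈-window (suc n) k k≤ with ℕ.m≤n⇒m<n∨m≡n k≤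
∈-window (suc n) k         k≤ | inj₁ (s≤s k≤n) = there (there (∈-window n k k≤n))
∈-window (suc n) (+ _)     k≤ | inj₂ refl      = here refl
∈-window (suc n) -[1+ _ ]  k≤ | inj₂ refl      = there (here refl)

term : ℕ → ℤ → ℤ
term N k = sign k ℤ.* b (+ N ℤ.- pentagonal k)

term-≡ : ∀ N k {p} → pentagonal k ≡ + p → term N k ≡ (C (sign k) ⊛ mono p ⊛ bSeries) N
term-≡ N k {p} eq = trans
  (cong (sign k ℤ.*_) (trans (cong (λ z → b (+ N ℤ.- z)) eq) (b-⊖ N p)))
  (sym (trans (at (R.*-assoc (C (sign k)) (mono p) bSeries) N) (C-⊛ (sign k) (mono p ⊛ bSeries) N)))

term-vanishes : ∀ N k → k ∉ window N → term N k ≡ 0ℤ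
term-vanishes N k k∉ = vanish k (ℕ.≰⇒> (λ k≤N → k∉ (∈-window N k k≤N)))
  where
  zero-term : ∀ k p → pentagonal k ≡ + p → N < p → term N k ≡ 0ℤ
  zero-term k p eq N<p = trans
    (cong (sign k ℤ.*_) (trans (cong (λ z → b (+ N ℤ.- z)) eq) (trans (b-⊖ N p) (mono-⊛-< bSeries N<p))))
    (ℤ.*-zeroʳ (sign k))
  -- The square alone suffices: k² ≥ |k| > N outside the window.
  N<square+ : ∀ {n} t → N < suc n → N < suc n * suc n + t
  N<square+ {n} t N<n = ℕ.<-≤-trans N<n (ℕ.≤-trans (ℕ.m≤m*n (suc n) (suc n)) (ℕ.m≤m+n (suc n * suc n) t))
  vanish : ∀ k → N < ℤ.∣ k ∣ → term N k ≡ 0ℤ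
  vanish (+ suc n) N< = zero-term (+ suc n) _ (pentagonal-+ n) (N<square+ (triangular n) N<)
  vanish -[1+ n ]  N< = zero-term -[1+ n ] _ (pentagonal-- n) (N<square+ (triangular (suc n)) N<)

sum-window : ∀ N n → sumOver (term N) (window n) ≡ (shanks n n ⊛ bSeries) N
sum-window N zero = trans (ℤ.+-identityʳ (term N (+ 0))) (trans (term-≡ N (+ 0) refl)
  (at (R.*-congʳ {bSeries} (R.*-identityˡ (C 1ℤ))) N))
sum-window N (suc n) = trans
  (cong₂ ℤ._+_ (term-≡ N (+ suc n) (pentagonal-+ n)) (cong₂ ℤ._+_ (term-≡ N -[1+ n ] (pentagonal-- n)) (sum-window N n)))
  (sym (at expand N))
  where
  f g : Series
  f = C (-1ℤ ℤ.^ suc n) ⊛ mono (suc n * suc n + triangular n)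
  g = C (-1ℤ ℤ.^ suc n) ⊛ mono (suc n * suc n + triangular (suc n))
  expand : shanks (suc n) (suc n) ⊛ bSeries ≈ f ⊛ bSeries ⊕ (g ⊛ bSeries ⊕ shanks n n ⊛ bSeries)
  expand = R.trans (R.*-congʳ {bSeries} (shanks-suc n))
    (solve 4 (λ f g s b → (f :+ (g :+ s)) :* b := f :* b :+ (g :* b :+ s :* b)) R.refl f g (shanks n n) bSeries)

-- Generating functions of partitions

total : ∀ {A : Set} → (A → ℤ) → List A → ℤ
total w = foldr (λ a acc → w a ℤ.+ acc) 0ℤ

module _ {A : Set} where

  total-cong : ∀ {v w : A → ℤ} {xs} → All (λ a → v a ≡ w a) xs → total v xs ≡ total w xs
  total-cong []       = refl
  total-cong (p ∷ ps) = cong₂ ℤ._+_ p (total-cong ps)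

  total-≗ : ∀ {v w : A → ℤ} → (∀ a → v a ≡ w a) → ∀ xs → total v xs ≡ total w xs
  total-≗ v≗w xs = total-cong (All.universal v≗w xs)

  total-++ : ∀ (w : A → ℤ) xs ys → total w (xs ++ ys) ≡ total w xs ℤ.+ total w ys
  total-++ w []       ys = sym (ℤ.+-identityˡ _)
  total-++ w (x ∷ xs) ys = trans (cong (λ z → w x ℤ.+ z) (total-++ w xs ys)) (sym (ℤ.+-assoc (w x) _ _))

  total-linear : ∀ a (v w : A → ℤ) xs → total (λ x → a ℤ.* v x ℤ.+ w x) xs ≡ a ℤ.* total v xs ℤ.+ total w xs
  total-linear a v w []       = sym (trans (ℤ.+-identityʳ _) (ℤ.*-zeroʳ a))
  total-linear a v w (x ∷ xs) rewrite total-linear a v w xs = rearrange a (v x) (w x) (total v xs) (total w xs)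
    where
    rearrange : ∀ a v w V W → (a ℤ.* v ℤ.+ w) ℤ.+ (a ℤ.* V ℤ.+ W) ≡ a ℤ.* (v ℤ.+ V) ℤ.+ (w ℤ.+ W)
    rearrange = solve-∀

  total-scale : ∀ a (v : A → ℤ) xs → total (λ x → a ℤ.* v x) xs ≡ a ℤ.* total v xs
  total-scale a v []       = sym (ℤ.*-zeroʳ a)
  total-scale a v (x ∷ xs) = trans (cong (λ z → a ℤ.* v x ℤ.+ z) (total-scale a v xs)) (sym (ℤ.*-distribˡ-+ a (v x) _))

  total-⊕ : ∀ (v w : A → ℤ) xs → total (λ x → v x ℤ.+ w x) xs ≡ total v xs ℤ.+ total w xs
  total-⊕ v w []       = refl
  total-⊕ v w (x ∷ xs) rewrite total-⊕ v w xs = rearrange (v x) (w x) (total v xs) (total w xs)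
    where
    rearrange : ∀ v w V W → (v ℤ.+ w) ℤ.+ (V ℤ.+ W) ≡ (v ℤ.+ V) ℤ.+ (w ℤ.+ W)
    rearrange = solve-∀

total-map : ∀ {A B : Set} (w : B → ℤ) (f : A → B) xs → total w (map f xs) ≡ total (w ∘ f) xs
total-map w f []       = refl
total-map w f (x ∷ xs) = cong (λ z → w (f x) ℤ.+ z) (total-map w f xs)

total-concatMap : ∀ {A B : Set} (w : B → ℤ) (f : A → List B) xs →
                  total w (concatMap f xs) ≡ total (λ a → total w (f a)) xs
total-concatMap w f []       = refl
total-concatMap w f (x ∷ xs) = trans (total-++ w (f x) (concatMap f xs))
                                     (cong (λ z → total w (f x) ℤ.+ z) (total-concatMap w f xs))

total-applyUpTo : ∀ {A : Set} (w : A → ℤ) (f : ℕ → A) n → total w (applyUpTo f n) ≡ total (w ∘ f) (upTo n)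
total-applyUpTo w f zero    = refl
total-applyUpTo w f (suc n) = cong (λ z → w (f 0) ℤ.+ z)
  (trans (total-applyUpTo w (f ∘ suc) n) (sym (total-applyUpTo (w ∘ f) suc n)))

-- The range of `j` is the one in `boundedPartitions`, so admitting the part k + 1 becomes
-- multiplication by c(q^(k+1)). Both sides, as functions of `c`, satisfy the same recursion.
dilate-⊛-coefficient : ∀ k c g n →
  (dilate (suc k) c ⊛ g) n ≡ total (λ j → c j ℤ.* g (n ∸ j * suc k)) (upTo (suc (n / suc k)))
dilate-⊛-coefficient k c g n = at (recursion-unique k {λ c → dilate (suc k) c ⊛ g} {Φ} {λ c → C (c 0) ⊛ g} (_∘ suc)
  (λ c → R.trans (R.*-congʳ {g} (dilate-rec (suc k) c))
    (solve 4 (λ c m t g → (c :+ m :* t) :* g := c :* g :+ m :* (t :* g)) R.refl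
             (C (c 0)) (mono (suc k)) (dilate (suc k) (c ∘ suc)) g))
  (λ c → coefficientwise (Φ-rec c)) c) n
  where
  summand : Series → ℕ → ℕ → ℤ
  summand c n j = c j ℤ.* g (n ∸ j * suc k)
  Φ : Series → Series
  Φ c n = total (summand c n) (upTo (suc (n / suc k)))
  Φ-rec : ∀ c n → Φ c n ≡ (C (c 0) ⊛ g) n ℤ.+ (mono (suc k) ⊛ Φ (c ∘ suc)) n
  Φ-rec c n = cong₂ ℤ._+_ (sym (C-⊛ (c 0) g n)) (trans (total-applyUpTo (summand c n) suc (n / suc k)) later)
    where
    later : total (summand c n ∘ suc) (upTo (n / suc k)) ≡ (mono (suc k) ⊛ Φ (c ∘ suc)) n
    later with n ℕ.<? suc k
    ... | yes n<k rewrite m<n⇒m/n≡0 n<k = sym (mono-⊛-< (Φ (c ∘ suc)) n<k)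
    ... | no  n≮k rewrite mono-⊛-≥ (Φ (c ∘ suc)) (ℕ.≮⇒≥ n≮k) | m/n≡1+[m∸n]/n (ℕ.≮⇒≥ n≮k) =
      total-≗ (λ j → cong (λ i → c (suc j) ℤ.* g i) (sym (ℕ.∸-+-assoc n (suc k) (j * suc k))))
              (upTo (suc ((n ∸ suc k) / suc k)))

boundedPartitions-≤ : ∀ m n → All (All (_≤ m)) (boundedPartitions m n)
boundedPartitions-≤ zero    zero    = [] ∷ []
boundedPartitions-≤ zero    (suc n) = []
boundedPartitions-≤ (suc m) n       = All.concat⁺ (All.map⁺ (All.universal (λ j → All.map⁺ (All.map
  (λ q≤m → All.++⁺ (All.replicate⁺ j ℕ.≤-refl) (All.map ℕ.m≤n⇒m≤1+n q≤m))
  (boundedPartitions-≤ m (n ∸ j * suc m)))) (upTo (suc (n / suc m)))))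

-- A part exceeding `n` can only have multiplicity 0. Hence one bound on the parts serves all
-- coefficients up to that bound.
boundedPartitions-stable : ∀ {m n} → n ≤ m → boundedPartitions m n ≡ partitions n
boundedPartitions-stable {m} {n} n≤m with ℕ.m≤n⇒m<n∨m≡n n≤m
boundedPartitions-stable {m}     {n} _ | inj₂ refl      = refl
boundedPartitions-stable {suc m} {n} _ | inj₁ (s≤s n≤m)
  rewrite m<n⇒m/n≡0 {n} {suc m} (s≤s n≤m) =
  trans (++-identityʳ _) (trans (map-id (boundedPartitions m n)) (boundedPartitions-stable n≤m))

Weight : Set
Weight = List ℕ → ℤ

gf : Weight → ℕ → Series
gf w m n = total w (boundedPartitions m n)

lengthTimes : Weight → Weight
lengthTimes u p = + length p ℤ.* u p

gf-suc : ∀ w m n → gf w (suc m) n ≡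
         total (λ j → total (λ q → w (replicate j (suc m) ++ q)) (boundedPartitions m (n ∸ j * suc m)))
               (upTo (suc (n / suc m)))
gf-suc w m n = trans
  (total-concatMap w (λ j → map (replicate j (suc m) ++_) (boundedPartitions m (n ∸ j * suc m))) (upTo (suc (n / suc m))))
  (total-≗ (λ j → total-map w (replicate j (suc m) ++_) (boundedPartitions m (n ∸ j * suc m))) (upTo (suc (n / suc m))))

length-replicate-++ : ∀ j (i : ℕ) q → length (replicate j i ++ q) ≡ j + length q
length-replicate-++ zero    i q = refl
length-replicate-++ (suc j) i q = cong suc (length-replicate-++ j i q)

-- Weighting by length multiplies a product generating function by its
-- logarithmic derivative in a variable marking the parts.
module Multiplicative (u : Weight) (c L : ℕ → Series)
  (u-[] : u [] ≡ 1ℤ)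
  (u-++ : ∀ m j {q} → All (_≤ m) q → u (replicate j (suc m) ++ q) ≡ c m j ℤ.* u q)
  (c-L : ∀ m → X∂ (c m) ≈ c m ⊛ L m)
  where

  ℓ : Weight
  ℓ = lengthTimes u

  factor logFactor : ℕ → Series
  factor    m = dilate (suc m) (c m)
  logFactor m = dilate (suc m) (L m)

  gf-step : ∀ m → gf u (suc m) ≈ factor m ⊛ gf u m
  gf-step m = coefficientwise λ n → trans (gf-suc u m n) (trans
    (total-≗ (λ j → trans
      (total-cong (All.map (u-++ m j) (boundedPartitions-≤ m (n ∸ j * suc m))))
      (total-scale (c m j) u (boundedPartitions m (n ∸ j * suc m)))) (upTo (suc (n / suc m))))
    (sym (dilate-⊛-coefficient m (c m) (gf u m) n)))

  -- The product rule: with j copies of the new part in front of q, the length is j + `length q`,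
  -- and the two summands give the two terms.
  gf-ℓ-step : ∀ m → gf ℓ (suc m) ≈ dilate (suc m) (X∂ (c m)) ⊛ gf u m ⊕ factor m ⊛ gf ℓ m
  gf-ℓ-step m = coefficientwise λ n → trans (gf-suc ℓ m n) (trans
    (total-≗ (λ j → trans
      (total-cong (All.map (ℓ-++ j) (boundedPartitions-≤ m (n ∸ j * suc m))))
      (trans (total-linear (X∂ (c m) j) u (λ q → c m j ℤ.* ℓ q) (boundedPartitions m (n ∸ j * suc m)))
             (cong (λ z → X∂ (c m) j ℤ.* gf u m (n ∸ j * suc m) ℤ.+ z)
                   (total-scale (c m j) ℓ (boundedPartitions m (n ∸ j * suc m))))))
      (upTo (suc (n / suc m))))
    (trans (total-⊕ (λ j → X∂ (c m) j ℤ.* gf u m (n ∸ j * suc m)) (λ j → c m j ℤ.* gf ℓ m (n ∸ j * suc m))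
                    (upTo (suc (n / suc m))))
           (sym (cong₂ ℤ._+_ (dilate-⊛-coefficient m (X∂ (c m)) (gf u m) n) (dilate-⊛-coefficient m (c m) (gf ℓ m) n)))))
    where
    rearrange : ∀ j l c u → (j ℤ.+ l) ℤ.* (c ℤ.* u) ≡ j ℤ.* c ℤ.* u ℤ.+ c ℤ.* (l ℤ.* u)
    rearrange = solve-∀
    ℓ-++ : ∀ j {q} → All (_≤ m) q → ℓ (replicate j (suc m) ++ q) ≡ X∂ (c m) j ℤ.* u q ℤ.+ c m j ℤ.* ℓ q
    ℓ-++ j {q} q≤m = trans
      (cong₂ ℤ._*_ (trans (cong +_ (length-replicate-++ j (suc m) q)) (ℤ.pos-+ j (length q))) (u-++ m j q≤m))
      (rearrange (+ j) (+ length q) (c m j) (u q))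

  gf-∏ : ∀ m → gf u m ≈ ∏ factor m
  gf-∏ zero    = coefficientwise λ { zero → trans (ℤ.+-identityʳ (u [])) u-[] ; (suc n) → refl }
  gf-∏ (suc m) = R.trans (gf-step m) (R.*-congˡ {factor m} (gf-∏ m))

  gf-length : ∀ m → gf ℓ m ≈ ∏ factor m ⊛ ∑ logFactor m
  gf-length zero    = R.trans (coefficientwise λ { zero → trans (ℤ.+-identityʳ (ℓ [])) (ℤ.*-zeroˡ (u []))
                                                     ; (suc n) → refl })
                              (R.sym (R.zeroʳ (C 1ℤ)))
  gf-length (suc m) = begin
    gf ℓ (suc m)
      ≈⟨ gf-ℓ-step m ⟩
    dilate (suc m) (X∂ (c m)) ⊛ gf u m ⊕ factor m ⊛ gf ℓ m
      ≈⟨ R.+-cong (R.*-cong (R.trans (dilate-cong (suc m) (c-L m)) (dilate-⊛ (suc m) (c m) (L m))) (gf-∏ m))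
                  (R.*-congˡ {factor m} (gf-length m)) ⟩
    factor m ⊛ logFactor m ⊛ ∏ factor m ⊕ factor m ⊛ (∏ factor m ⊛ ∑ logFactor m)
      ≈⟨ solve 4 (λ f l P S → f :* l :* P :+ f :* (P :* S) := f :* P :* (l :+ S)) R.refl
           (factor m) (logFactor m) (∏ factor m) (∑ logFactor m) ⟩
    ∏ factor (suc m) ⊛ ∑ logFactor (suc m) ∎

-- The weights for odd and for distinct parts

indicator : {P : Pred (List ℕ) 0ℓ} → Decidable P → Weight
indicator P? p = if does (P? p) then 1ℤ else 0ℤ

totalParts-total : {P : Pred (List ℕ) 0ℓ} (P? : Decidable P) → ∀ n →
                   + totalParts P? n ≡ total (lengthTimes (indicator P?)) (partitions n)
totalParts-total P? n = go (partitions n)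
  where
  go : ∀ ps → + sum (map length (filter P? ps)) ≡ total (lengthTimes (indicator P?)) ps
  go []       = refl
  go (p ∷ ps) with does (P? p)
  ... | true  = trans (ℤ.pos-+ (length p) _) (cong₂ ℤ._+_ (sym (ℤ.*-identityʳ (+ length p))) (go ps))
  ... | false = trans (go ps) (sym (trans
    (cong (ℤ._+ total (lengthTimes (indicator P?)) ps) (ℤ.*-zeroʳ (+ length p))) (ℤ.+-identityˡ _)))

odd-∷ : ∀ i p → indicator oddParts? (i ∷ p) ≡ χ i ℤ.* indicator oddParts? p
odd-∷ i p = table (does (2 ∣? i)) (does (oddParts? p))
  where
  table : ∀ s t → (if not s ∧ t then 1ℤ else 0ℤ) ≡ (if s then 0ℤ else 1ℤ) ℤ.* (if t then 1ℤ else 0ℤ)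
  table true  true  = refl
  table true  false = refl
  table false true  = refl
  table false false = refl

odd-++ : ∀ i j q → indicator oddParts? (replicate j i ++ q) ≡ geometric (χ i) j ℤ.* indicator oddParts? q
odd-++ i zero    q = sym (ℤ.*-identityˡ _)
odd-++ i (suc j) q = trans (odd-∷ i (replicate j i ++ q))
  (trans (cong (χ i ℤ.*_) (odd-++ i j q)) (sym (ℤ.*-assoc (χ i) (geometric (χ i) j) (indicator oddParts? q))))

module Odd = Multiplicative (indicator oddParts?) (λ m → geometric (χ (suc m))) (λ m → geometric⁺ (χ (suc m))) refl
  (λ m j {q} _ → odd-++ (suc m) j q) (λ m → X∂-geometric (χ (suc m)))

-- The value r = 1 counts the partitions into distinct parts, r = -1 signs them by the parity of
-- their length.
distinctWeight : ℤ → Weight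
distinctWeight r p = if does (distinctParts? p) then r ℤ.^ length p else 0ℤ

-- Since the parts of `q` are at most `m`, distinctness only limits the new part suc m to at most
-- one copy, whence the factor 1 + r q^(m+1).
distinct-++ : ∀ r m j {q} → All (_≤ m) q →
              distinctWeight r (replicate j (suc m) ++ q) ≡ linear r j ℤ.* distinctWeight r q
distinct-++ r m zero          q≤m = sym (ℤ.*-identityˡ _)
distinct-++ r m (suc zero) {q} q≤m = trans (cong (if_then r ℤ.* r ℤ.^ length q else 0ℤ) same)
                                           (pull (does (distinctParts? q)))
  where
  same : does (distinctParts? (suc m ∷ q)) ≡ does (distinctParts? q)
  same = does-⇔ (mk⇔ (λ { (_ ∷ uq) → uq }) (All.map (λ { y≤m refl → ℕ.1+n≰n y≤m }) q≤m ∷_))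
                (distinctParts? (suc m ∷ q)) (distinctParts? q)
  pull : ∀ t {y} → (if t then r ℤ.* y else 0ℤ) ≡ r ℤ.* (if t then y else 0ℤ)
  pull true  = refl
  pull false = sym (ℤ.*-zeroʳ r)
distinct-++ r m (suc (suc j)) {q} q≤m
  rewrite dec-false (distinctParts? (suc m ∷ suc m ∷ (replicate j (suc m) ++ q))) (λ { ((m≢m ∷ _) ∷ _) → m≢m refl }) =
  sym (ℤ.*-zeroˡ (distinctWeight r q))

module Distinct (r : ℤ) = Multiplicative (distinctWeight r) (λ _ → linear r) (λ _ → C r ⊛ X ⊛ geometric (ℤ.- r)) refl
  (distinct-++ r) (λ _ → X∂-linear r)

[-1]^-parity : ∀ n → -1ℤ ℤ.^ n ≡ (if does (2 ∣? n) then 1ℤ else -1ℤ)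
[-1]^-parity zero          = refl
[-1]^-parity (suc zero)    = refl
[-1]^-parity (suc (suc n)) = trans (cong (λ z → -1ℤ ℤ.* (-1ℤ ℤ.* z)) ([-1]^-parity n))
  (trans (double (does (2 ∣? n))) (cong (if_then 1ℤ else -1ℤ) (does-⇔
    (mk⇔ (ℕ.∣m∣n⇒∣m+n ℕ.∣-refl) (λ d → ℕ.∣m+n∣m⇒∣n d ℕ.∣-refl)) (2 ∣? n) (2 ∣? (2 + n)))))
  where
  double : ∀ t → -1ℤ ℤ.* (-1ℤ ℤ.* (if t then 1ℤ else -1ℤ)) ≡ (if t then 1ℤ else -1ℤ)
  double true  = refl
  double false = refl

odd-total : ∀ {m n} → n ≤ m → + totalParts oddParts? n ≡ gf Odd.ℓ m n
odd-total {m} {n} n≤m = trans (totalParts-total oddParts? n) (cong (total Odd.ℓ) (sym (boundedPartitions-stable n≤m)))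

distinct-total : ∀ {m n} → n ≤ m → + totalParts distinctParts? n ≡ gf (Distinct.ℓ 1ℤ) m n
distinct-total {m} {n} n≤m = trans (totalParts-total distinctParts? n) (trans
  (total-≗ (λ p → cong (λ y → + length p ℤ.* (if does (distinctParts? p) then y else 0ℤ))
                       (sym (ℤ.^-zeroˡ (length p))))
           (partitions n))
  (cong (total (Distinct.ℓ 1ℤ)) (sym (boundedPartitions-stable n≤m))))

-- At r = -1 the even lengths count positively, whereas `s` counts the odd ones positively; this is
-- the factor -1.
s-total : ∀ {m n} → n ≤ m → s n ≡ (C -1ℤ ⊛ gf (Distinct.ℓ -1ℤ) m) n
s-total {m} {n} n≤m = trans
  (cong₂ ℤ._-_ (trans (totalParts-total odd? n) (trans
                  (total-≗ pointwise (partitions n))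
                  (total-linear -1ℤ (Distinct.ℓ -1ℤ) (lengthTimes (indicator even?)) (partitions n))))
               (totalParts-total even? n))
  (trans (cancel _ (total (lengthTimes (indicator even?)) (partitions n)))
    (trans (cong (λ ps → -1ℤ ℤ.* total (Distinct.ℓ -1ℤ) ps) (sym (boundedPartitions-stable n≤m)))
           (sym (C-⊛ -1ℤ (gf (Distinct.ℓ -1ℤ) m) n))))
  where
  odd? = oddlyManyDistinctParts?
  even? = evenlyManyDistinctParts?
  signed : ∀ d t l → l ℤ.* (if d ∧ not t then 1ℤ else 0ℤ) ≡
                     -1ℤ ℤ.* (l ℤ.* (if d then (if t then 1ℤ else -1ℤ) else 0ℤ)) ℤ.+ l ℤ.* (if d ∧ t then 1ℤ else 0ℤ)
  signed false _     = solve-∀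
  signed true  true  = solve-∀
  signed true  false = solve-∀
  pointwise : ∀ p → lengthTimes (indicator odd?) p ≡ -1ℤ ℤ.* Distinct.ℓ -1ℤ p ℤ.+ lengthTimes (indicator even?) p
  pointwise p = trans (signed (does (distinctParts? p)) (does (2 ∣? length p)) (+ length p))
    (cong (λ y → -1ℤ ℤ.* (+ length p ℤ.* (if does (distinctParts? p) then y else 0ℤ)) ℤ.+ lengthTimes (indicator even?) p)
          (sym ([-1]^-parity (length p))))
  cancel : ∀ x y → x ℤ.+ y ℤ.- y ≡ x
  cancel = solve-∀

-- Truncation and the coefficient `N`

∑-lambert-≤ : ∀ {i m n} → i ≤ m → m ≤ n → ∑ lambert n i ≡ ∑ lambert m i
∑-lambert-≤ {i} {m} {n} i≤m m≤n with ℕ.m≤n⇒m<n∨m≡n m≤n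
∑-lambert-≤ {i} {m} {n}     i≤m m≤n | inj₂ refl      = refl
∑-lambert-≤ {i} {m} {suc n} i≤m m≤n | inj₁ (s≤s m≤n′) =
  trans (cong (ℤ._+ ∑ lambert n i) (vanishes i (ℕ.≤-trans i≤m m≤n′))) (trans (ℤ.+-identityˡ _) (∑-lambert-≤ i≤m m≤n′))
  where
  vanishes : ∀ i → i ≤ n → lambert n i ≡ 0ℤ
  vanishes zero    _   = dilate-zero n (geometric⁺ 1ℤ)
  vanishes (suc i) i<n = dilate-< n (geometric⁺ 1ℤ) i i<n

-- The logarithmic derivative of 1 - qⁱ is -qⁱ/(1 - qⁱ); its sign cancels the one in `s-total`.
∑-lambert-signed : ∀ m → ∑ (Distinct.logFactor -1ℤ) m ≈ C -1ℤ ⊛ ∑ lambert m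
∑-lambert-signed zero    = R.sym (R.zeroʳ (C -1ℤ))
∑-lambert-signed (suc m) = begin
  dilate (suc m) (C -1ℤ ⊛ X ⊛ geometric 1ℤ) ⊕ ∑ (Distinct.logFactor -1ℤ) m
    ≈⟨ R.+-cong (R.trans (dilate-cong (suc m)
                       (solve 2 (λ X g → con -1ℤ :* X :* g := con -1ℤ :* (con 1ℤ :* X :* g)) R.refl X (geometric 1ℤ)))
                         (dilate-C⊛ (suc m) -1ℤ (geometric⁺ 1ℤ)))
                (∑-lambert-signed m) ⟩
  C -1ℤ ⊛ lambert m ⊕ C -1ℤ ⊛ ∑ lambert m
    ≈⟨ R.distribˡ (C -1ℤ) (lambert m) (∑ lambert m) ⟨
  C -1ℤ ⊛ ∑ lambert (suc m) ∎

module _ (N : ℕ) where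

  private
    P Λ Λ₂ O D : Series
    P  = ∏ [q] N
    Λ  = ∑ lambert N
    Λ₂ = dilate 2 Λ
    -- The cut-off is doubled because `euler-odd` and `∑-lambert-odd` relate 2N part sizes to N
    -- dilated ones.
    O  = gf Odd.ℓ (N * 2)
    D  = gf (Distinct.ℓ 1ℤ) N

  s-≡ : ∀ {n} → n ≤ N → s n ≡ (P ⊛ Λ) n
  s-≡ {n} n≤N = trans (s-total n≤N) (at (begin
    C -1ℤ ⊛ gf (Distinct.ℓ -1ℤ) N
      ≈⟨ R.*-congˡ {C -1ℤ} (Distinct.gf-length -1ℤ N) ⟩
    C -1ℤ ⊛ (P ⊛ ∑ (Distinct.logFactor -1ℤ) N)
      ≈⟨ R.*-congˡ {C -1ℤ} (R.*-congˡ {P} (∑-lambert-signed N)) ⟩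
    C -1ℤ ⊛ (P ⊛ (C -1ℤ ⊛ Λ))
      ≈⟨ solve 2 (λ p l → con -1ℤ :* (p :* (con -1ℤ :* l)) := p :* l) R.refl P Λ ⟩
    P ⊛ Λ ∎) n)

  P⊛D : P ⊛ D ≈ dilate 2 P ⊛ (Λ ⊕ ⊝ (C (+ 2) ⊛ Λ₂))
  P⊛D = begin
    P ⊛ D
      ≈⟨ R.*-congˡ {P} (Distinct.gf-length 1ℤ N) ⟩
    P ⊛ (∏ [-q] N ⊛ A)
      ≈⟨ R.*-assoc P (∏ [-q] N) A ⟨
    P ⊛ ∏ [-q] N ⊛ A
      ≈⟨ R.*-cong (euler-distinct N) (solve 2 (λ a b → a := (a :+ b) :+ :- b) R.refl A (C (+ 2) ⊛ Λ₂)) ⟩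
    dilate 2 P ⊛ (A ⊕ C (+ 2) ⊛ Λ₂ ⊕ ⊝ (C (+ 2) ⊛ Λ₂))
      ≈⟨ R.*-congˡ {dilate 2 P} (R.+-congʳ {⊝ (C (+ 2) ⊛ Λ₂)} (∑-lambert-alternating N)) ⟩
    dilate 2 P ⊛ (Λ ⊕ ⊝ (C (+ 2) ⊛ Λ₂)) ∎
    where A = ∑ lambertAlternating N

  -- Unlike `P⊛D`, this is claimed for one coefficient only: `P` and `Λ` have to be exchanged with
  -- their counterparts at 2N, which agree with them only up to coefficient `N`.
  P⊛O : (P ⊛ O) N ≡ (dilate 2 P ⊛ (Λ ⊕ ⊝ Λ₂)) N
  P⊛O = trans (⊛-cong-≤ N {g = O} (λ i≤N → sym (∏[q]-≤ i≤N N≤2N)) (λ _ → refl)) (trans (at expand N)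
    (⊛-cong-≤ N {dilate 2 P} (λ _ → refl) (λ {i} i≤N → cong (ℤ._+ (⊝ Λ₂) i) (∑-lambert-≤ i≤N N≤2N))))
    where
    N≤2N : N ≤ N * 2
    N≤2N = ℕ.m≤m*n N 2
    A = ∑ lambertOdd (N * 2)
    expand : ∏ [q] (N * 2) ⊛ O ≈ dilate 2 P ⊛ (∑ lambert (N * 2) ⊕ ⊝ Λ₂)
    expand = begin
      ∏ [q] (N * 2) ⊛ O
        ≈⟨ R.*-congˡ {∏ [q] (N * 2)} (Odd.gf-length (N * 2)) ⟩
      ∏ [q] (N * 2) ⊛ (∏ oddGeometric (N * 2) ⊛ A)
        ≈⟨ R.*-assoc (∏ [q] (N * 2)) (∏ oddGeometric (N * 2)) A ⟨
      ∏ [q] (N * 2) ⊛ ∏ oddGeometric (N * 2) ⊛ A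
        ≈⟨ R.*-cong (euler-odd N) (solve 2 (λ a b → a := (a :+ b) :+ :- b) R.refl A Λ₂) ⟩
      dilate 2 P ⊛ (A ⊕ Λ₂ ⊕ ⊝ Λ₂)
        ≈⟨ R.*-congˡ {dilate 2 P} (R.+-congʳ {⊝ Λ₂} (∑-lambert-odd N)) ⟩
      dilate 2 P ⊛ (∑ lambert (N * 2) ⊕ ⊝ Λ₂) ∎

  P⊛b : (shanks N N ⊛ bSeries) N ≡ dilate 2 (P ⊛ Λ) N
  P⊛b = trans
    -- Only coefficients up to `N` matter, so the pentagonal sum becomes `P` and `bSeries` becomes
    -- `O` minus `D`, despite their different cut-offs.
    (⊛-cong-≤ N (λ i≤N → shanks-≤ N N i≤N)
      (λ i≤N → cong₂ ℤ._-_ (odd-total (ℕ.≤-trans i≤N (ℕ.m≤m*n N 2))) (distinct-total i≤N)))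
    (trans (at (solve 3 (λ p o d → p :* (o :+ :- d) := p :* o :+ :- (p :* d)) R.refl P O D) N)
    (trans (cong₂ ℤ._-_ P⊛O (at P⊛D N))
    (trans (at (solve 3 (λ f l k → f :* (l :+ :- k) :+ :- (f :* (l :+ :- (con (+ 2) :* k)))
                            := f :* k) R.refl (dilate 2 P) Λ Λ₂) N)
           (sym (at (dilate-⊛ 2 P Λ) N)))))

corollary2p2 : (n : ℕ) → HasSum (λ k → sign k ℤ.* b (+ n ℤ.- pentagonal k)) (if does (2 ∣? n) then s (n / 2) else 0ℤ)
corollary2p2 n = record
  { indices  = window n
  ; distinct = window-unique n
  ; vanishes = term-vanishes n
  -- Unfolded, `dilate 2` of the product at `n` is already the case distinction of the claim; `s-≡`
  -- applies to its first branch because n / 2 ≤ n.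
  ; value    = trans (sum-window n n) (trans (P⊛b n)
                 (cong (if does (2 ∣? n) then_else 0ℤ) (sym (s-≡ n (m/n≤m n 2)))))
  }
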